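{- (a) Let $\Gamma$ be a triangulation of a connected closed surface $M$ with a fixed $z$-orientation $\tau$ such that every face of $\Gamma$ is of type I and every zigzag in $\tau$ is homogeneous. Let $\Gamma_{II}$ be the subgraph of $\Gamma$ formed by all vertices of type II and all edges of type II (directed as type II edges). Then $\Gamma_{II}$ is a closed $2$-cell embedding in $M$ of a connected simple Eulerian digraph (every vertex has in-degree equal to out-degree) in which the boundary of every face is a directed cycle, and $\Gamma=\mathrm{T}(\Gamma_{II})$. (b) Conversely, let $\Gamma'$ be a closed $2$-cell embedding in $M$ of a connected simple Eulerian digraph such that the boundary of every face is a directed cycle. Then the triangulation $\mathrm{T}(\Gamma')$ admits a unique $z$-orientation for which all faces are of type I, all zigzags are homogeneous, and $\Gamma'$ (with its directions) is exactly the subgraph of $\mathrm{T}(\Gamma')$ formed by all vertices and edges of type II (with their type II directions).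
   Context: Let $M$ be a connected closed $2$-dimensional surface (not necessarily orientable). A triangulation of $M$ is a $2$-cell embedding of a connected simple finite graph in $M$ such that every face is a triangle. A zigzag in a triangulation $\Gamma$ is a sequence of edges $(e_i)_{i\in\mathbb N}$ such that for every $i$: $e_i$ and $e_{i+1}$ are distinct edges of a common face; the face containing $e_i,e_{i+1}$ is different from the face containing $e_{i+1},e_{i+2}$; and $e_i$, $e_{i+2}$ have no common vertex. It is regarded as a cyclic sequence $e_1,\dots,e_n$ ($n$ the minimal period), and passes through each of its edges in a definite direction (from the vertex shared with the previous edge to the vertex shared with the next). The reversal $Z^{ -1}$ of a zigzag is a zigzag, $Z\ne Z^{ -1}$. If $\Gamma$ has exactly $k$ zigzags up to reversal, a $z$-orientation is a set $\tau$ of $k$ zigzags containing exactly one of $Z,Z^{ -1}$ for each zigzag $Z$. For a $z$-orientation, each edge either occurs twice in one zigzag of $\tau$ or once in each of two distinct zigzags of $\tau$ (and in no others); it is of type I if these two passages are in opposite directions and of type II if in the same direction (type II edges are directed accordingly). A vertex is of type I if all edges containing it are of type I, otherwise of type II. A face is of type I if it contains exactly two edges of type I and one edge of type II. When all faces are of type I, a zigzag is homogeneous if it is a cyclic sequence $e_1,e_1',e_1'',e_2,e_2',e_2'',\dots,e_n,e_n',e_n''$ in which every $e_i$ is of type II and every $e_i',e_i''$ is of type I. A $2$-cell embedding is closed if every face is homeomorphic to a closed $2$-disc. For a closed $2$-cell embedding $\Gamma'$ of a connected simple finite graph in $M$, $\mathrm{T}(\Gamma')$ denotes the triangulation of $M$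 obtained by choosing a point $v_F$ in the interior of every face $F$, adding all $v_F$ as vertices, and joining each $v_F$ by an edge (inside $F$) to every vertex of $F$. -}

module Defs where

open import Data.Bool.Base using (Bool; true; false; not)
open import Data.Empty using (⊥)
open import Data.Fin.Base using (Fin)
open import Data.Fin.Patterns using (0F; 1F; 2F)
open import Data.Fin.Properties using (*↔×)
open import Data.Nat.Base using (ℕ; suc; _+_; _*_; _∸_; _≤_; _>_)
open import Data.Product.Base using (∃; ∃₂; _×_; _,_; proj₁; proj₂)
open import Data.Product.Function.NonDependent.Propositional using (_×-↔_)
open import Data.Sum.Base using (_⊎_; inj₁; inj₂)
open import Function.Base using (_∘_)
open import Function.Bundles using (_⇔_; _↔_; Inverse)
open import Function.Properties.Inverse using (↔-refl; ↔-sym; ↔-trans)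
open import Relation.Binary.Construct.Closure.ReflexiveTransitive
  using (Star; ε; _◅_; _◅◅_)
open import Relation.Binary.PropositionalEquality.Core
  using (_≡_; _≢_; refl; cong)
open import Relation.Nullary.Negation.Core using (¬_)

-- A 2-cell embedding of a connected finite graph (with at least one edge) in
-- a connected closed surface, orientable or not, is given, up to
-- homeomorphism, by its flags: the triangles of the barycentric subdivision,
-- i.e. the mutually incident triples (vertex, edge, face) counted with
-- multiplicity.  The involution r₀ (r₁, r₂) moves a flag to the adjacent flag
-- that differs from it only in the vertex (edge, face).  The surface is
-- recovered by gluing the triangles.
record Map : Set₁ where
  field
    Flag      : Set
    finite    : ∃ λ n → Flag ↔ Fin n
    inhabited : Flag
    r₀ r₁ r₂  : Flag → Flag

    r₀-invol  : ∀ x → r₀ (r₀ x) ≡ x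
    r₁-invol  : ∀ x → r₁ (r₁ x) ≡ x
    r₂-invol  : ∀ x → r₂ (r₂ x) ≡ x

    r₀-free   : ∀ x → r₀ x ≢ x
    r₁-free   : ∀ x → r₁ x ≢ x
    r₂-free   : ∀ x → r₂ x ≢ x

    -- every edge has exactly four flags (two ends, two sides)
    r₀r₂-comm : ∀ x → r₀ (r₂ x) ≡ r₂ (r₀ x)
    r₀r₂-free : ∀ x → r₀ (r₂ x) ≢ x

    connected : ∀ x y → Star (λ a b → r₀ a ≡ b ⊎ r₁ a ≡ b ⊎ r₂ a ≡ b) x y

  Orbit : (f g : Flag → Flag) → Flag → Flag → Set
  Orbit f g = Star (λ a b → f a ≡ b ⊎ g a ≡ b)

  infix 4 _~ᵛ_ _~ᵉ_ _~ᶠ_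

  -- Vertices, edges and faces are the classes of flags under the following
  -- equivalence relations (orbits of involutions); below, a flag is used to
  -- denote its vertex, its edge or its face.
  _~ᵛ_ _~ᵉ_ _~ᶠ_ : Flag → Flag → Set
  _~ᵛ_ = Orbit r₁ r₂
  _~ᵉ_ = Orbit r₀ r₂
  _~ᶠ_ = Orbit r₀ r₁

  -- x and y denote the same edge, directed away from the vertex of the flag
  SameDart : Flag → Flag → Set
  SameDart x y = x ≡ y ⊎ r₂ x ≡ y

  -- the vertex of v lies on the edge of e
  _∈ᵉ_ : Flag → Flag → Set
  v ∈ᵉ e = ∃ λ x → x ~ᵛ v × x ~ᵉ e

  -- the edge of e lies on the face of f
  _∈ᶠ_ : Flag → Flag → Set
  e ∈ᶠ f = ∃ λ x → x ~ᵉ e × x ~ᶠ f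

  record IsSimple : Set where
    field
      no-loops      : ∀ x → ¬ (x ~ᵛ r₀ x)
      no-multiedges : ∀ x y → x ~ᵛ y → r₀ x ~ᵛ r₀ y → x ~ᵉ y

  -- Every face is a closed disc: its boundary walk repeats neither a vertex
  -- nor an edge.
  record IsClosed : Set where
    field
      vertex-once : ∀ x y → x ~ᶠ y → x ~ᵛ y → y ≡ x ⊎ y ≡ r₁ x
      edge-once   : ∀ x y → x ~ᶠ y → x ~ᵉ y → y ≡ x ⊎ y ≡ r₀ x

  -- Boundary walks of faces have length 3.  Length 1 would be a loop, which
  -- is excluded by simplicity wherever this is used.
  IsTriangular : Set
  IsTriangular = ∀ x → r₁ (r₀ (r₁ (r₀ (r₁ (r₀ x))))) ≡ x

record Triangulation : Set₁ where
  field
    map        : Map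
    simple     : Map.IsSimple map
    triangular : Map.IsTriangular map
  open Map map public
  open IsSimple simple public

record ClosedEmbedding : Set₁ where
  field
    map    : Map
    simple : Map.IsSimple map
    closed : Map.IsClosed map
  open Map map public
  open IsSimple simple public
  open IsClosed closed public

-- Homeomorphism of surfaces carrying one embedded graph onto the other, up to
-- isotopy.
record _≅_ (Γ Δ : Map) : Set where
  private
    module Γ = Map Γ
    module Δ = Map Δ
  field
    bijection : Γ.Flag ↔ Δ.Flag
  open Inverse bijection public using (to; from)
  field
    r₀-hom : ∀ x → to (Γ.r₀ x) ≡ Δ.r₀ (to x)
    r₁-hom : ∀ x → to (Γ.r₁ x) ≡ Δ.r₁ (to x)
    r₂-hom : ∀ x → to (Γ.r₂ x) ≡ Δ.r₂ (to x)

≅-refl : ∀ {Γ} → Γ ≅ Γ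
≅-refl = record
  { bijection = ↔-refl
  ; r₀-hom = λ _ → refl ; r₁-hom = λ _ → refl ; r₂-hom = λ _ → refl }

-- A choice of direction of every edge.
record Orientation (Γ : Map) : Set where
  open Map Γ
  field
    -- out x ≡ true: the edge of x is directed away from the vertex of x
    out    : Flag → Bool
    out-r₂ : ∀ x → out (r₂ x) ≡ out x
    out-r₀ : ∀ x → out (r₀ x) ≡ not (out x)

  -- exactly k edges leave (b = true) or enter (b = false) the vertex of v
  record HasDegree (b : Bool) (v : Flag) (k : ℕ) : Set where
    field
      dart      : Fin k → Flag
      at-vertex : ∀ i → dart i ~ᵛ v
      direction : ∀ i → out (dart i) ≡ b
      distinct  : ∀ i j → SameDart (dart i) (dart j) → i ≡ j
      complete  : ∀ x → x ~ᵛ v → out x ≡ b → ∃ λ i → SameDart (dart i) x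

  IsEulerian : Set
  IsEulerian = ∀ v → ∃ λ k → HasDegree true v k × HasDegree false v k

  -- an edge of a face boundary and the next one, r₁ (r₀ x), are both directed
  -- along or both directed against the boundary walk
  HasDirectedFaces : Set
  HasDirectedFaces = ∀ x → out (r₁ (r₀ x)) ≡ out x

-- A connected simple Eulerian digraph, closed 2-cell embedded so that the
-- boundary of every face is a directed cycle.
record EulerianEmbedding : Set₁ where
  field
    embedding      : ClosedEmbedding
    orientation    : Orientation (ClosedEmbedding.map embedding)
    eulerian       : Orientation.IsEulerian orientation
    directed-faces : Orientation.HasDirectedFaces orientation
  open ClosedEmbedding embedding public
  open Orientation orientation public

-- The triangulation T(G).  The triangle with vertices v_F, a, b, where ab is
-- an edge of the face F, arises from two flags of G, x at a and r₀ x at b.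
-- Its six flags are those of x and of r₀ x, where the flags of x are
--   (x , 0F): vertex a,   edge ab;
--   (x , 1F): vertex a,   edge a v_F;
--   (x , 2F): vertex v_F, edge a v_F.
module _ (G : ClosedEmbedding) where
  private
    module G = ClosedEmbedding G

  TFlag : Set
  TFlag = G.Flag × Fin 3

  T-r₀ T-r₁ T-r₂ : TFlag → TFlag
  T-r₀ (x , 0F) = G.r₀ x , 0F
  T-r₀ (x , 1F) = x , 2F
  T-r₀ (x , 2F) = x , 1F

  T-r₁ (x , 0F) = x , 1F
  T-r₁ (x , 1F) = x , 0F
  T-r₁ (x , 2F) = G.r₀ x , 2F

  T-r₂ (x , 0F) = G.r₂ x , 0F
  T-r₂ (x , 1F) = G.r₁ x , 1F
  T-r₂ (x , 2F) = G.r₁ x , 2F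

  private
    Step : TFlag → TFlag → Set
    Step a b = T-r₀ a ≡ b ⊎ T-r₁ a ≡ b ⊎ T-r₂ a ≡ b

    lift : ∀ {x y} →
           Star (λ a b → G.r₀ a ≡ b ⊎ G.r₁ a ≡ b ⊎ G.r₂ a ≡ b) x y →
           Star Step (x , 0F) (y , 0F)
    lift ε = ε
    lift (inj₁ refl ◅ p) = inj₁ refl ◅ lift p
    lift (inj₂ (inj₁ refl) ◅ p) =
      inj₂ (inj₁ refl) ◅ inj₂ (inj₂ refl) ◅ inj₂ (inj₁ refl) ◅ lift p
    lift (inj₂ (inj₂ refl) ◅ p) = inj₂ (inj₂ refl) ◅ lift p

    down : ∀ x i → Star Step (x , i) (x , 0F)
    down x 0F = ε
    down x 1F = inj₂ (inj₁ refl) ◅ ε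
    down x 2F = inj₁ refl ◅ inj₂ (inj₁ refl) ◅ ε

    up : ∀ x i → Star Step (x , 0F) (x , i)
    up x 0F = ε
    up x 1F = inj₂ (inj₁ refl) ◅ ε
    up x 2F = inj₂ (inj₁ refl) ◅ inj₁ refl ◅ ε

  T-map : Map
  T-map = record
    { Flag = TFlag
    ; finite = proj₁ G.finite * 3
             , ↔-trans (proj₂ G.finite ×-↔ ↔-refl) (↔-sym *↔×)
    ; inhabited = G.inhabited , 0F
    ; r₀ = T-r₀ ; r₁ = T-r₁ ; r₂ = T-r₂
    ; r₀-invol = λ where
        (x , 0F) → cong (_, 0F) (G.r₀-invol x)
        (x , 1F) → refl
        (x , 2F) → refl
    ; r₁-invol = λ where
        (x , 0F) → refl
        (x , 1F) → refl
        (x , 2F) → cong (_, 2F) (G.r₀-invol x)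
    ; r₂-invol = λ where
        (x , 0F) → cong (_, 0F) (G.r₂-invol x)
        (x , 1F) → cong (_, 1F) (G.r₁-invol x)
        (x , 2F) → cong (_, 2F) (G.r₁-invol x)
    ; r₀-free = λ where
        (x , 0F) p → G.r₀-free x (cong proj₁ p)
        (x , 1F) ()
        (x , 2F) ()
    ; r₁-free = λ where
        (x , 0F) ()
        (x , 1F) ()
        (x , 2F) p → G.r₀-free x (cong proj₁ p)
    ; r₂-free = λ where
        (x , 0F) p → G.r₂-free x (cong proj₁ p)
        (x , 1F) p → G.r₁-free x (cong proj₁ p)
        (x , 2F) p → G.r₁-free x (cong proj₁ p)
    ; r₀r₂-comm = λ where
        (x , 0F) → cong (_, 0F) (G.r₀r₂-comm x)
        (x , 1F) → refl
        (x , 2F) → refl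
    ; r₀r₂-free = λ where
        (x , 0F) p → G.r₀r₂-free x (cong proj₁ p)
        (x , 1F) ()
        (x , 2F) ()
    ; connected = λ where
        (x , i) (y , j) → down x i ◅◅ lift (G.connected x y) ◅◅ up y j
    }

  private
    module T = Map T-map

    -- the vertices of T(G) are the vertices and the faces of G
    SameVertex : TFlag → TFlag → Set
    SameVertex (x , 2F) (y , 2F) = x G.~ᶠ y
    SameVertex (x , 2F) (y , _)  = ⊥
    SameVertex (x , _)  (y , 2F) = ⊥
    SameVertex (x , _)  (y , _)  = x G.~ᵛ y

    sv-refl : ∀ p → SameVertex p p
    sv-refl (x , 0F) = ε
    sv-refl (x , 1F) = ε
    sv-refl (x , 2F) = ε

    sv-r₁ : ∀ p q → SameVertex (T-r₁ p) q → SameVertex p q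
    sv-r₁ (x , 0F) (y , 0F) s = s
    sv-r₁ (x , 0F) (y , 1F) s = s
    sv-r₁ (x , 1F) (y , 0F) s = s
    sv-r₁ (x , 1F) (y , 1F) s = s
    sv-r₁ (x , 0F) (y , 2F) ()
    sv-r₁ (x , 1F) (y , 2F) ()
    sv-r₁ (x , 2F) (y , 0F) ()
    sv-r₁ (x , 2F) (y , 1F) ()
    sv-r₁ (x , 2F) (y , 2F) s = inj₁ refl ◅ s

    sv-r₂ : ∀ p q → SameVertex (T-r₂ p) q → SameVertex p q
    sv-r₂ (x , 0F) (y , 0F) s = inj₂ refl ◅ s
    sv-r₂ (x , 0F) (y , 1F) s = inj₂ refl ◅ s
    sv-r₂ (x , 1F) (y , 0F) s = inj₁ refl ◅ s
    sv-r₂ (x , 1F) (y , 1F) s = inj₁ refl ◅ s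
    sv-r₂ (x , 0F) (y , 2F) ()
    sv-r₂ (x , 1F) (y , 2F) ()
    sv-r₂ (x , 2F) (y , 0F) ()
    sv-r₂ (x , 2F) (y , 1F) ()
    sv-r₂ (x , 2F) (y , 2F) s = inj₂ refl ◅ s

    sameVertex : ∀ {p q} → p T.~ᵛ q → SameVertex p q
    sameVertex {p} ε = sv-refl p
    sameVertex {p} {q} (inj₁ refl ◅ s) = sv-r₁ p q (sameVertex s)
    sameVertex {p} {q} (inj₂ refl ◅ s) = sv-r₂ p q (sameVertex s)

    lift-~ᵉ : ∀ {x y} → x G.~ᵉ y → (x , 0F) T.~ᵉ (y , 0F)
    lift-~ᵉ ε = ε
    lift-~ᵉ (inj₁ refl ◅ s) = inj₁ refl ◅ lift-~ᵉ s
    lift-~ᵉ (inj₂ refl ◅ s) = inj₂ refl ◅ lift-~ᵉ s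

    spoke : ∀ x y → y ≡ x ⊎ y ≡ G.r₁ x → (x , 1F) T.~ᵉ (y , 1F)
    spoke x y (inj₁ refl) = ε
    spoke x y (inj₂ refl) = inj₂ refl ◅ ε

    no-loops : ∀ p → ¬ SameVertex p (T-r₀ p)
    no-loops (x , 0F) s = G.no-loops x s
    no-loops (x , 1F) ()
    no-loops (x , 2F) ()

    no-multiedges : ∀ p q → SameVertex p q → SameVertex (T-r₀ p) (T-r₀ q) →
                    p T.~ᵉ q
    no-multiedges (x , 0F) (y , 0F) s t = lift-~ᵉ (G.no-multiedges x y s t)
    no-multiedges (x , 1F) (y , 1F) s t = spoke x y (G.vertex-once x y t s)
    no-multiedges (x , 2F) (y , 2F) s t =
      inj₁ refl ◅ spoke x y (G.vertex-once x y s t) ◅◅ inj₁ refl ◅ ε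
    no-multiedges (x , 0F) (y , 1F) s ()
    no-multiedges (x , 1F) (y , 0F) s ()
    no-multiedges (x , 0F) (y , 2F) ()
    no-multiedges (x , 1F) (y , 2F) ()
    no-multiedges (x , 2F) (y , 0F) ()
    no-multiedges (x , 2F) (y , 1F) ()

  T : Triangulation
  T = record
    { map = T-map
    ; simple = record
        { no-loops = λ p s → no-loops p (sameVertex s)
        ; no-multiedges =
            λ p q s t → no-multiedges p q (sameVertex s) (sameVertex t) }
    ; triangular = λ where
        (x , 0F) → cong (_, 0F) (G.r₀-invol x)
        (x , 1F) → cong (_, 1F) (G.r₀-invol x)
        (x , 2F) → cong (_, 2F) (G.r₀-invol x)
    }

module _ (Γ : Triangulation) where
  open Triangulation Γ

  -- Sequences of edges, each edge being represented by any of its flags.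
  EdgeSeq : Set
  EdgeSeq = ℕ → Flag

  _≈_ : EdgeSeq → EdgeSeq → Set
  z ≈ w = ∀ i → z i ~ᵉ w i

  DistinctEdgesOf : (f e e′ : Flag) → Set
  DistinctEdgesOf f e e′ = e ∈ᶠ f × e′ ∈ᶠ f × ¬ (e ~ᵉ e′)

  record IsZigzag (z : EdgeSeq) : Set where
    field
      turn   : ∀ i → ∃₂ λ f g →
               DistinctEdgesOf f (z i) (z (1 + i)) ×
               DistinctEdgesOf g (z (1 + i)) (z (2 + i)) ×
               ¬ (f ~ᶠ g)
      zigzag : ∀ i v → v ∈ᵉ z i → ¬ (v ∈ᵉ z (2 + i))

  HasPeriod : EdgeSeq → ℕ → Set
  HasPeriod z n = ∀ i → z (n + i) ~ᵉ z i

  -- w is the reversal of the cyclic sequence z (up to a cyclic shift)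
  IsReversal : EdgeSeq → EdgeSeq → Set
  IsReversal z w = ∃ λ n → n > 0 × HasPeriod z n × HasPeriod w n ×
                   (∀ i → i ≤ n → w i ~ᵉ z (n ∸ i))

  -- A set of zigzags, these being regarded as cyclic sequences, is a predicate
  -- invariant under shifts.  The premise of cyclic is needed: if z ∘ suc is a
  -- zigzag, z 0 may still be any edge.
  record ZOrientation : Set₁ where
    field
      _∈τ      : EdgeSeq → Set
      zigzags  : ∀ {z} → z ∈τ → IsZigzag z
      resp-≈   : ∀ {z w} → z ≈ w → z ∈τ → w ∈τ
      cyclic   : ∀ {z} → IsZigzag z → z ∈τ ⇔ (z ∘ suc) ∈τ
      choice   : ∀ {z w} → IsZigzag z → IsReversal z w →
                 (z ∈τ ⊎ w ∈τ) × ¬ (z ∈τ × w ∈τ)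

  -- z passes through its edge z 1, which is the edge of x, from the vertex of
  -- x (shared with z 0) to the vertex of r₀ x (shared with z 2).  Passages of
  -- a cyclic sequence through an edge correspond to the shifts of it that have
  -- this edge in position 1, so distinct passages are distinct sequences.
  Passes : EdgeSeq → Flag → Set
  Passes z x = z 1 ~ᵉ x × x ∈ᵉ z 0 × r₀ x ∈ᵉ z 2

  module _ (τ : ZOrientation) where
    open ZOrientation τ

    EdgeI : Flag → Set
    EdgeI x = ∃₂ λ z w → z ∈τ × w ∈τ × ¬ (z ≈ w) ×
              Passes z x × Passes w (r₀ x)

    -- the edge of x is of type II and directed away from the vertex of x
    DirectedII : Flag → Set
    DirectedII x = ∃₂ λ z w → z ∈τ × w ∈τ × ¬ (z ≈ w) ×
                   Passes z x × Passes w x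

    EdgeII : Flag → Set
    EdgeII x = DirectedII x ⊎ DirectedII (r₀ x)

    VertexI VertexII : Flag → Set
    VertexI v  = ∀ x → x ~ᵛ v → EdgeI x
    VertexII v = ¬ VertexI v

    -- the edges of the face of y are those of y, r₁ y and r₁ (r₀ y)
    FaceI : Flag → Set
    FaceI f = ∃ λ y → y ~ᶠ f × EdgeII y × EdgeI (r₁ y) × EdgeI (r₁ (r₀ y))

    Homogeneous : EdgeSeq → Set
    Homogeneous z = ∃ λ c → ∀ k →
      EdgeII (z (3 * k + c)) ×
      EdgeI (z (1 + (3 * k + c))) ×
      EdgeI (z (2 + (3 * k + c)))

    AllFacesI : Set
    AllFacesI = ∀ f → FaceI f

    AllHomogeneous : Set
    AllHomogeneous = ∀ z → z ∈τ → Homogeneous z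

-- Under the identification φ of T(D) with Γ, the digraph D consists precisely
-- of the vertices and the directed edges of type II.
record IsΓII (D : EulerianEmbedding) (Γ : Triangulation) (τ : ZOrientation Γ)
             (φ : T-map (EulerianEmbedding.embedding D) ≅ Triangulation.map Γ)
             : Set where
  open EulerianEmbedding D using (out)
  open Triangulation Γ using (_~ᵛ_; SameDart)
  open _≅_ φ using (to)
  field
    vertices : ∀ v → VertexII Γ τ v ⇔ (∃ λ y → to (y , 0F) ~ᵛ v)
    edges    : ∀ x → DirectedII Γ τ x ⇔
               (∃ λ y → out y ≡ true × SameDart (to (y , 0F)) x)

{-# OPTIONS --safe #-}

-- Write next x = r₀ r₂ r₁ x.  Every zigzag is, edge by edge, an orbit of next,
-- and its flag x is unique as soon as no vertex has degree 2; the reversed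
-- zigzag is the orbit of r₀ r₂ x, or of r₁ x up to a shift.  Hence a
-- z-orientation is the same as a two-colouring of the flags (sign below) that
-- changes under r₁ and under r₀ r₂, and the edge of x is of type II if and
-- only if x and r₂ x have the same colour, which then gives its direction.
--
-- (a) The flags on edges of type II, with r₀, r₂ and the rotation r₁ r₂ r₁,
-- form the digraph.  Homogeneity ensures that the rotation preserves them, so
-- that the edges of type II of the faces around a vertex v of type I bound a
-- face with v as its centre.
--
-- (b) The directions prescribe the colours of the flags on edges of the
-- digraph, and these determine all the others; the resulting colouring is
-- consistent because the faces are directed cycles.
module Submission where

open import Axiom.UniquenessOfIdentityProofs using (module Decidable⇒UIP)
open import Data.Bool.Base using (Bool; true; false; not)
open import Data.Bool.Properties using (not-involutive; not-injective; not-¬; ¬-not)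
import Data.Bool.Properties as Bool
open import Data.Empty using (⊥)
open import Data.Fin.Base using (Fin; zero; suc; toℕ; fromℕ<; join; splitAt)
open import Data.Fin.Patterns using (0F; 1F; 2F)
import Data.Fin.Properties as Fin
open import Data.Nat.Base using (ℕ; zero; suc; _+_; _*_; _∸_; _≤_)
import Data.Nat.Base as ℕ
open import Data.Nat.DivMod using (_/_; _%_; _divMod_; result; m≡m%n+[m/n]*n; m%n<n)
open import Data.Nat.GeneralisedArithmetic using (iterate)
import Data.Nat.Properties as ℕ
open import Data.Product.Base using (Σ; Σ-syntax; ∃; ∃₂; _×_; _,_; proj₁; proj₂)
open import Data.Sum.Base using (_⊎_; inj₁; inj₂; [_,_]′)
open import Function.Base using (_∘_)
open import Function.Bundles using (_⇔_; _↔_; Inverse; Equivalence; mk⇔; mk↔ₛ′)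
open import Function.Definitions using (Injective)
open import Relation.Binary.Construct.Closure.ReflexiveTransitive
  using (Star; ε; _◅_; _◅◅_; reverse)
open import Relation.Binary.Definitions using (DecidableEquality; tri<; tri≈; tri>)
open import Relation.Binary.PropositionalEquality
open import Relation.Nullary using (¬_; Dec; yes; no; contradiction; _×-dec_; _⊎-dec_)
open import Relation.Nullary.Decidable using (map′)
open import Relation.Unary using (Decidable)
open import Defs

-- Iteration and finite sets

module _ {A : Set} (f : A → A) where

  iterate-comm : ∀ x n → iterate f (f x) n ≡ f (iterate f x n)
  iterate-comm x zero    = refl
  iterate-comm x (suc n) = iterate-comm (f x) n

  iterate-+ : ∀ x m n → iterate f x (m + n) ≡ iterate f (iterate f x m) n
  iterate-+ x zero    n = refl
  iterate-+ x (suc m) n = iterate-+ (f x) m n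

  iterate-* : ∀ x m n → iterate f x n ≡ x → iterate f x (m * n) ≡ x
  iterate-* x zero    n p = refl
  iterate-* x (suc m) n p = begin
    iterate f x (n + m * n)             ≡⟨ iterate-+ x n (m * n) ⟩
    iterate f (iterate f x n) (m * n)   ≡⟨ cong (λ y → iterate f y (m * n)) p ⟩
    iterate f x (m * n)                 ≡⟨ iterate-* x m n p ⟩
    x                                   ∎
    where open ≡-Reasoning

  iterate-cancel : Injective _≡_ _≡_ f →
    ∀ x m n → iterate f x (m + n) ≡ iterate f x m → iterate f x n ≡ x
  iterate-cancel inj x zero    n p = p
  iterate-cancel inj x (suc m) n p =
    inj (trans (sym (iterate-comm x n)) (iterate-cancel inj (f x) m n p))

involutive⇒injective : {A : Set} {f : A → A} →
  (∀ x → f (f x) ≡ x) → Injective _≡_ _≡_ f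
involutive⇒injective {f = f} invol {x} {y} p =
  trans (sym (invol x)) (trans (cong f p) (invol y))

join-injective : ∀ m {n} → Injective _≡_ _≡_ (join m n)
join-injective m {n} {x} {y} p =
  trans (sym (Fin.splitAt-join m n x))
        (trans (cong (splitAt m) p) (Fin.splitAt-join m n y))

splitAt-injective : ∀ m {n} → Injective _≡_ _≡_ (splitAt m {n})
splitAt-injective m {n} {x} {y} p =
  trans (sym (Fin.join-splitAt m n x))
        (trans (cong (join m n) p) (Fin.join-splitAt m n y))

-- The elements satisfying `P` are listed once each, however many proofs of `P` they have.
-- Uniqueness of these proofs enters in `finite-subset`.
record Enumeration {A : Set} (P : A → Set) : Set where
  field
    size           : ℕ
    elem           : Fin size → A
    elem-injective : Injective _≡_ _≡_ elem
    sound          : ∀ i → P (elem i)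
    index          : ∀ {x} → P x → Fin size
    elem-index     : ∀ {x} (p : P x) → elem (index p) ≡ x

enumerateFin : ∀ n {P : Fin n → Set} → Decidable P → Enumeration P
enumerateFin zero P? = record
  { size = 0 ; elem = λ () ; elem-injective = λ {} ; sound = λ ()
  ; index = λ { {()} } ; elem-index = λ { {()} } }
enumerateFin (suc n) {P} P? with enumerateFin n (P? ∘ suc) | P? zero
... | E | yes p₀ = record
  { size = suc size ; elem = elem′ ; elem-injective = injective
  ; sound = λ { zero → p₀ ; (suc i) → sound i }
  ; index = λ { {zero} _ → zero ; {suc x} p → suc (index p) }
  ; elem-index = λ { {zero} _ → refl ; {suc x} p → cong suc (elem-index p) } }
  where
  open Enumeration E
  elem′ : Fin (suc size) → Fin (suc n)
  elem′ zero    = zero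
  elem′ (suc i) = suc (elem i)
  injective : Injective _≡_ _≡_ elem′
  injective {zero}  {zero}  _ = refl
  injective {suc i} {suc j} p = cong suc (elem-injective (Fin.suc-injective p))
... | E | no ¬p₀ = record
  { size = size ; elem = suc ∘ elem
  ; elem-injective = elem-injective ∘ Fin.suc-injective
  ; sound = sound
  ; index = λ { {zero} p → contradiction p ¬p₀ ; {suc x} p → index p }
  ; elem-index = λ { {zero} p → contradiction p ¬p₀
                   ; {suc x} p → cong suc (elem-index p) } }
  where open Enumeration E

module Finite {A : Set} {n : ℕ} (A↔Fin : A ↔ Fin n) where
  open Inverse A↔Fin using (to; from; strictlyInverseˡ; strictlyInverseʳ)

  to-injective : Injective _≡_ _≡_ to
  to-injective {x} {y} p =
    trans (sym (strictlyInverseʳ x)) (trans (cong from p) (strictlyInverseʳ y))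

  infix 4 _≟_
  _≟_ : DecidableEquality A
  x ≟ y = map′ to-injective (cong to) (to x Fin.≟ to y)

  enumerate : {P : A → Set} → Decidable P → Enumeration P
  enumerate {P} P? = record
    { size = size
    ; elem = from ∘ elem
    ; elem-injective = λ {i} {j} p → elem-injective
        (trans (sym (strictlyInverseˡ _)) (trans (cong to p) (strictlyInverseˡ _)))
    ; sound = sound
    ; index = λ p → index (subst P (sym (strictlyInverseʳ _)) p)
    ; elem-index = λ p →
        trans (cong from (elem-index (subst P (sym (strictlyInverseʳ _)) p)))
              (strictlyInverseʳ _)
    }
    where open Enumeration (enumerateFin n (P? ∘ from))

  finite-subset : {P : A → Set} → Decidable P → (∀ {x} (p q : P x) → p ≡ q) →
                  ∃ λ m → Σ A P ↔ Fin m
  finite-subset {P} P? irr = size , mk↔ₛ′ (λ (_ , p) → index p)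
    (λ i → elem i , sound i)
    (λ i → elem-injective (elem-index (sound i)))
    (λ (_ , p) → pair-≡ (elem-index p))
    where
    open Enumeration (enumerate P?)
    pair-≡ : ∀ {x y} {p : P x} {q : P y} → x ≡ y → (x , p) ≡ (y , q)
    pair-≡ refl = cong (_ ,_) (irr _ _)

  -- Two of the first `n + 1` iterates coincide by the pigeonhole principle, and injectivity cancels
  -- their common initial segment.
  finite-order : {f : A → A} → Injective _≡_ _≡_ f →
                 ∀ x → ∃ λ k → iterate f x (suc k) ≡ x
  finite-order {f} inj x
    with i , j , i<j , p ← Fin.pigeonhole (ℕ.n<1+n n) (λ i → to (iterate f x (toℕ i)))
    with k , q ← ℕ.m≤n⇒∃[o]m+o≡n i<j
    = k , iterate-cancel f inj x (toℕ i) (suc k)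
            (trans (cong (iterate f x) (trans (ℕ.+-suc (toℕ i) k) q))
                   (sym (to-injective p)))

module DihedralOrbit {A : Set} {n : ℕ} (A↔Fin : A ↔ Fin n) {f g : A → A}
  (f-invol : ∀ x → f (f x) ≡ x) (g-invol : ∀ x → g (g x) ≡ x) where
  open Finite A↔Fin

  private
    Orb : A → A → Set
    Orb = Star (λ a b → f a ≡ b ⊎ g a ≡ b)

    rot : A → A
    rot = g ∘ f

    rot-injective : Injective _≡_ _≡_ rot
    rot-injective =
      involutive⇒injective {f = f} f-invol ∘ involutive⇒injective {f = g} g-invol

  -- Two involutions generate a dihedral group, so the orbit consists of the iterates of `x` under
  -- `rot` up to a period and of their images under `f`. Membership is then a finite search.
  orbit? : ∀ x y → Dec (Orb x y)
  orbit? x y with k , period ← finite-order rot-injective x =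
    map′ hit⇒orb (closed hit-start)
      (Fin.any? λ i → iterate rot x (toℕ i) ≟ y ⊎-dec f (iterate rot x (toℕ i)) ≟ y)
    where
    Hit : A → Set
    Hit y = ∃ λ (i : Fin (suc k)) →
            iterate rot x (toℕ i) ≡ y ⊎ f (iterate rot x (toℕ i)) ≡ y

    orb-rot : ∀ i → Orb x (iterate rot x i)
    orb-rot zero    = ε
    orb-rot (suc i) = orb-rot i ◅◅ inj₁ refl ◅ inj₂ (sym (iterate-comm rot x i)) ◅ ε

    hit⇒orb : ∀ {y} → Hit y → Orb x y
    hit⇒orb (i , inj₁ refl) = orb-rot (toℕ i)
    hit⇒orb (i , inj₂ refl) = orb-rot (toℕ i) ◅◅ inj₁ refl ◅ ε

    hit : ∀ {i} → i ℕ.< suc k → Hit (iterate rot x i)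
    hit i<k = fromℕ< i<k , inj₁ (cong (iterate rot x) (Fin.toℕ-fromℕ< i<k))

    hit-f : ∀ {i} → i ℕ.< suc k → Hit (f (iterate rot x i))
    hit-f i<k = fromℕ< i<k , inj₂ (cong (f ∘ iterate rot x) (Fin.toℕ-fromℕ< i<k))

    hit-start : Hit x
    hit-start = hit ℕ.z<s

    hit-suc : ∀ {i} → i ℕ.< suc k → Hit (rot (iterate rot x i))
    hit-suc {i} i<k with ℕ.m≤n⇒m<n∨m≡n i<k
    ... | inj₁ i+1<k = subst Hit (iterate-comm rot x i) (hit i+1<k)
    ... | inj₂ refl  =
      subst Hit (trans (sym period) (iterate-comm rot x i)) hit-start

    hit-g : ∀ {i} → i ℕ.< suc k → Hit (g (iterate rot x i))
    -- As `rot` is `g ∘ f`, the map `g` sends an iterate to the image under `f` of the preceding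
    -- one. The predecessor of `x` itself is the last iterate of the period.
    hit-g {zero} _ = subst Hit (trans (sym (g-invol _)) (cong g p)) (hit-f (ℕ.n<1+n k))
      where
      p : rot (iterate rot x k) ≡ x
      p = trans (sym (iterate-comm rot x k)) period
    hit-g {suc i} i<k = subst Hit (trans (sym (g-invol _)) (cong g (sym (iterate-comm rot x i))))
      (hit-f (ℕ.<-trans (ℕ.n<1+n i) i<k))

    step : ∀ {y z} → Hit y → f y ≡ z ⊎ g y ≡ z → Hit z
    step (i , inj₁ refl) (inj₁ refl) = hit-f (Fin.toℕ<n i)
    step (i , inj₂ refl) (inj₁ refl) = subst Hit (sym (f-invol _)) (hit (Fin.toℕ<n i))
    step (i , inj₁ refl) (inj₂ refl) = hit-g (Fin.toℕ<n i)
    step (i , inj₂ refl) (inj₂ refl) = hit-suc (Fin.toℕ<n i)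

    closed : ∀ {y z} → Hit y → Orb y z → Hit z
    closed h ε       = h
    closed h (s ◅ p) = closed (step h s) p

-- Maps and triangulations

module MapProperties (Γ : Map) where
  open Map Γ

  ~ᵛ-sym : ∀ {x y} → x ~ᵛ y → y ~ᵛ x
  ~ᵛ-sym = reverse λ
    { (inj₁ refl) → inj₁ (r₁-invol _) ; (inj₂ refl) → inj₂ (r₂-invol _) }

  ~ᵉ-sym : ∀ {x y} → x ~ᵉ y → y ~ᵉ x
  ~ᵉ-sym = reverse λ
    { (inj₁ refl) → inj₁ (r₀-invol _) ; (inj₂ refl) → inj₂ (r₂-invol _) }

  ~ᶠ-sym : ∀ {x y} → x ~ᶠ y → y ~ᶠ x
  ~ᶠ-sym = reverse λ
    { (inj₁ refl) → inj₁ (r₀-invol _) ; (inj₂ refl) → inj₂ (r₁-invol _) }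

  r₁-~ᵛ : ∀ {x} → x ~ᵛ r₁ x
  r₁-~ᵛ = inj₁ refl ◅ ε

  r₂-~ᵛ : ∀ {x} → x ~ᵛ r₂ x
  r₂-~ᵛ = inj₂ refl ◅ ε

  r₀-~ᵉ : ∀ {x} → x ~ᵉ r₀ x
  r₀-~ᵉ = inj₁ refl ◅ ε

  r₂-~ᵉ : ∀ {x} → x ~ᵉ r₂ x
  r₂-~ᵉ = inj₂ refl ◅ ε

  r₀-~ᶠ : ∀ {x} → x ~ᶠ r₀ x
  r₀-~ᶠ = inj₁ refl ◅ ε

  r₁-~ᶠ : ∀ {x} → x ~ᶠ r₁ x
  r₁-~ᶠ = inj₂ refl ◅ ε

  ≡⇒~ᵛ : ∀ {x y} → x ≡ y → x ~ᵛ y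
  ≡⇒~ᵛ refl = ε

  ≡⇒~ᵉ : ∀ {x y} → x ≡ y → x ~ᵉ y
  ≡⇒~ᵉ refl = ε

  r₀-injective : Injective _≡_ _≡_ r₀
  r₀-injective = involutive⇒injective r₀-invol

  r₁-injective : Injective _≡_ _≡_ r₁
  r₁-injective = involutive⇒injective r₁-invol

  r₂-injective : Injective _≡_ _≡_ r₂
  r₂-injective = involutive⇒injective r₂-invol

  sameDart⇒~ᵛ : ∀ {x y} → SameDart x y → x ~ᵛ y
  sameDart⇒~ᵛ (inj₁ refl) = ε
  sameDart⇒~ᵛ (inj₂ refl) = r₂-~ᵛ

  sameDart-r₀ : ∀ {x y} → SameDart x y → SameDart (r₀ x) (r₀ y)
  sameDart-r₀ (inj₁ refl) = inj₁ refl
  sameDart-r₀ (inj₂ refl) = inj₂ (sym (r₀r₂-comm _))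

  -- Since `r₀` and `r₂` commute, an edge has only the flags `x`, `r₂ x`, `r₀ x` and `r₂ (r₀ x)`,
  -- two at each end.
  ~ᵉ⇒sameDart : ∀ {x y} → x ~ᵉ y → SameDart x y ⊎ SameDart (r₀ x) y
  ~ᵉ⇒sameDart ε = inj₁ (inj₁ refl)
  ~ᵉ⇒sameDart {x} (inj₁ refl ◅ p) with ~ᵉ⇒sameDart p
  ... | inj₁ d = inj₂ d
  ... | inj₂ d = inj₁ (subst (λ u → SameDart u _) (r₀-invol x) d)
  ~ᵉ⇒sameDart {x} (inj₂ refl ◅ p) with ~ᵉ⇒sameDart p
  ... | inj₁ (inj₁ q) = inj₁ (inj₂ q)
  ... | inj₁ (inj₂ q) = inj₁ (inj₁ (trans (sym (r₂-invol x)) q))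
  ... | inj₂ (inj₁ q) = inj₂ (inj₂ (trans (sym (r₀r₂-comm x)) q))
  ... | inj₂ (inj₂ q) =
    inj₂ (inj₁ (trans (sym (r₂-invol _)) (trans (cong r₂ (sym (r₀r₂-comm x))) q)))

  ∈ᵉ⇒~ᵛ : ∀ {v e} → v ∈ᵉ e → v ~ᵛ e ⊎ v ~ᵛ r₀ e
  ∈ᵉ⇒~ᵛ (x , x~v , x~e) with ~ᵉ⇒sameDart (~ᵉ-sym x~e)
  ... | inj₁ d = inj₁ (~ᵛ-sym x~v ◅◅ ~ᵛ-sym (sameDart⇒~ᵛ d))
  ... | inj₂ d = inj₂ (~ᵛ-sym x~v ◅◅ ~ᵛ-sym (sameDart⇒~ᵛ d))

  ∈ᵉ-resp-~ᵉ : ∀ {v e e′} → e ~ᵉ e′ → v ∈ᵉ e → v ∈ᵉ e′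
  ∈ᵉ-resp-~ᵉ p (x , x~v , x~e) = x , x~v , x~e ◅◅ p

  module _ (simple : IsSimple) where
    open IsSimple simple

    sameVertex⇒sameDart : ∀ {x y} → x ~ᵛ y → x ~ᵉ y → SameDart x y
    sameVertex⇒sameDart p q with ~ᵉ⇒sameDart q
    ... | inj₁ d = d
    ... | inj₂ d = contradiction (p ◅◅ ~ᵛ-sym (sameDart⇒~ᵛ d)) (no-loops _)

-- Degrees in an orientation with directed faces

module OrientationProperties {Γ : Map} (ω : Orientation Γ) where
  open Map Γ
  open MapProperties Γ
  open Orientation ω
  open Finite (proj₂ finite)

  module _ (directed : HasDirectedFaces) where

    -- At each corner of a directed face boundary one side comes in and the other goes out.
    out-r₁ : ∀ x → out (r₁ x) ≡ not (out x)
    out-r₁ x = begin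
      out (r₁ x)             ≡⟨ cong (out ∘ r₁) (r₀-invol x) ⟨
      out (r₁ (r₀ (r₀ x)))   ≡⟨ directed (r₀ x) ⟩
      out (r₀ x)             ≡⟨ out-r₀ x ⟩
      not (out x)            ∎
      where open ≡-Reasoning

    private
      rank : Flag → ℕ
      rank = toℕ ∘ Inverse.to (proj₂ finite)

      -- One flag is selected from each pair {x , r₂ x}.
      Selected : Bool → Flag → Flag → Set
      Selected b v x = v ~ᵛ x × out x ≡ b × rank x ℕ.< rank (r₂ x)

      darts : ∀ b v → Enumeration (Selected b v)
      darts b v = enumerate λ x →
        DihedralOrbit.orbit? (proj₂ finite) r₁-invol r₂-invol v x
        ×-dec (out x Bool.≟ b ×-dec rank x ℕ.<? rank (r₂ x))

      module Darts b v = Enumeration (darts b v)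

      distinct : ∀ b v i j → SameDart (Darts.elem b v i) (Darts.elem b v j) → i ≡ j
      distinct b v i j (inj₁ p) = Darts.elem-injective b v p
      distinct b v i j (inj₂ p) = contradiction
        (subst (λ y → rank y ℕ.< rank (r₂ y)) (sym p) (proj₂ (proj₂ (Darts.sound b v j))))
        (subst (λ y → ¬ (rank (r₂ (Darts.elem b v i)) ℕ.< rank y)) (sym (r₂-invol _))
          (ℕ.<-asym (proj₂ (proj₂ (Darts.sound b v i)))))

      find : ∀ b v x → v ~ᵛ x → out x ≡ b → ∃ λ i → SameDart (Darts.elem b v i) x
      find b v x p q with ℕ.<-cmp (rank x) (rank (r₂ x))
      ... | tri< lt _ _ = Darts.index b v s , inj₁ (Darts.elem-index b v s)
        where s = p , q , lt
      ... | tri≈ _ eq _ = contradiction (sym (to-injective (Fin.toℕ-injective eq))) (r₂-free x)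
      ... | tri> _ _ gt = Darts.index b v s ,
          inj₂ (trans (cong r₂ (Darts.elem-index b v s)) (r₂-invol x))
        where
        s : Selected b v (r₂ x)
        s = p ◅◅ r₂-~ᵛ , trans (out-r₂ x) q
          , subst (λ y → rank (r₂ x) ℕ.< rank y) (sym (r₂-invol x)) gt

      hasDegree : ∀ b v → HasDegree b v (Darts.size b v)
      hasDegree b v = record
        { dart      = Darts.elem b v
        ; at-vertex = λ i → ~ᵛ-sym (proj₁ (Darts.sound b v i))
        ; direction = λ i → proj₁ (proj₂ (Darts.sound b v i))
        ; distinct  = distinct b v
        ; complete  = λ x p → find b v x (~ᵛ-sym p) }

    private
      module _ {b v n m} (D : HasDegree b v n) (E : HasDegree (not b) v m) where
        module D = HasDegree D
        module E = HasDegree E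

        outer : Fin n ⊎ Fin n → Flag
        outer (inj₁ i) = D.dart i
        outer (inj₂ i) = r₂ (D.dart i)

        outer-injective : Injective _≡_ _≡_ outer
        outer-injective {inj₁ i} {inj₁ j} p = cong inj₁ (D.distinct i j (inj₁ p))
        outer-injective {inj₂ i} {inj₂ j} p =
          cong inj₂ (D.distinct i j (inj₁ (r₂-injective p)))
        outer-injective {inj₁ i} {inj₂ j} p with D.distinct j i (inj₂ (sym p))
        ... | refl = contradiction (sym p) (r₂-free _)
        outer-injective {inj₂ i} {inj₁ j} p with D.distinct i j (inj₂ p)
        ... | refl = contradiction p (r₂-free _)

        outer-at-vertex : ∀ i → r₁ (outer i) ~ᵛ v
        outer-at-vertex (inj₁ i) = ~ᵛ-sym r₁-~ᵛ ◅◅ D.at-vertex i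
        outer-at-vertex (inj₂ i) = ~ᵛ-sym (r₂-~ᵛ ◅◅ r₁-~ᵛ) ◅◅ D.at-vertex i

        outer-direction : ∀ i → out (r₁ (outer i)) ≡ not b
        outer-direction (inj₁ i) = trans (out-r₁ _) (cong not (D.direction i))
        outer-direction (inj₂ i) =
          trans (out-r₁ _) (cong not (trans (out-r₂ _) (D.direction i)))

        inner : Fin m ⊎ Fin m → Flag
        inner (inj₁ i) = E.dart i
        inner (inj₂ i) = r₂ (E.dart i)

        match : ∀ i → ∃ λ j → inner j ≡ r₁ (outer i)
        match i with E.complete _ (outer-at-vertex i) (outer-direction i)
        ... | j , inj₁ p = inj₁ j , p
        ... | j , inj₂ p = inj₂ j , p

        match-injective : Injective _≡_ _≡_ (proj₁ ∘ match)
        match-injective {i} {j} p = outer-injective (r₁-injective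
          (trans (sym (proj₂ (match i))) (trans (cong inner p) (proj₂ (match j)))))

        -- Around a vertex, r₁ exchanges the flags of outgoing edges with those
        -- of incoming edges, and every edge end has two flags.
        degree-≤ : n ≤ m
        -- The injection gives `n + n ≤ m + m`, which contradicts `m < n`.
        degree-≤ = ℕ.≮⇒≥ λ m<n → ℕ.<⇒≱ (ℕ.+-mono-< m<n m<n)
          (Fin.injective⇒≤ {f = join m m ∘ proj₁ ∘ match ∘ splitAt n}
            (splitAt-injective n ∘ match-injective ∘ join-injective m))

    directed⇒eulerian : IsEulerian
    directed⇒eulerian v =
      Darts.size true v , hasDegree true v ,
      subst (HasDegree false v)
        (ℕ.≤-antisym (degree-≤ (hasDegree false v) (hasDegree true v))
                     (degree-≤ (hasDegree true v) (hasDegree false v)))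
        (hasDegree false v)

-- Faces of a triangulation

module TriangulationProperties (Γ : Triangulation) where
  open Triangulation Γ
  open MapProperties map

  -- This is the braid relation, an equivalent form of `triangular`; it brings every word in `r₀`
  -- and `r₁` to one of six normal forms.
  r₁r₀r₁ : ∀ x → r₁ (r₀ (r₁ x)) ≡ r₀ (r₁ (r₀ x))
  r₁r₀r₁ x = begin
    r₁ (r₀ (r₁ x))                                           ≡⟨ cong (r₁ ∘ r₀ ∘ r₁) (triangular x) ⟨
    r₁ (r₀ (r₁ (r₁ (r₀ (r₁ (r₀ (r₁ (r₀ x))))))))             ≡⟨ cong (r₁ ∘ r₀) (r₁-invol _) ⟩
    r₁ (r₀ (r₀ (r₁ (r₀ (r₁ (r₀ x))))))                       ≡⟨ cong r₁ (r₀-invol _) ⟩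
    r₁ (r₁ (r₀ (r₁ (r₀ x))))                                 ≡⟨ r₁-invol _ ⟩
    r₀ (r₁ (r₀ x))                                           ∎
    where open ≡-Reasoning

  -- The flags of the face of x are the corner (w , i) with w = x or w = r₀ x;
  -- the indices are those of the flags of T.
  corner : Flag × Fin 3 → Flag
  corner (w , 0F) = w
  corner (w , 1F) = r₁ w
  corner (w , 2F) = r₀ (r₁ w)

  data FaceFlag (x : Flag) : Flag → Set where
    same     : ∀ i → FaceFlag x (corner (x , i))
    opposite : ∀ i → FaceFlag x (corner (r₀ x , i))

  faceFlag-r₀ : ∀ {x y} → FaceFlag x y → FaceFlag x (r₀ y)
  faceFlag-r₀ (same 0F)     = opposite 0F
  faceFlag-r₀ (same 1F)     = same 2F
  faceFlag-r₀ (same 2F)     = subst (FaceFlag _) (sym (r₀-invol _)) (same 1F)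
  faceFlag-r₀ (opposite 0F) = subst (FaceFlag _) (sym (r₀-invol _)) (same 0F)
  faceFlag-r₀ (opposite 1F) = opposite 2F
  faceFlag-r₀ (opposite 2F) = subst (FaceFlag _) (sym (r₀-invol _)) (opposite 1F)

  faceFlag-r₁ : ∀ {x y} → FaceFlag x y → FaceFlag x (r₁ y)
  faceFlag-r₁ (same 0F)     = same 1F
  faceFlag-r₁ (same 1F)     = subst (FaceFlag _) (sym (r₁-invol _)) (same 0F)
  faceFlag-r₁ (same 2F)     = subst (FaceFlag _) (sym (r₁r₀r₁ _)) (opposite 2F)
  faceFlag-r₁ (opposite 0F) = opposite 1F
  faceFlag-r₁ (opposite 1F) = subst (FaceFlag _) (sym (r₁-invol _)) (opposite 0F)
  faceFlag-r₁ {x} (opposite 2F) = subst (FaceFlag _)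
    (sym (trans (r₁r₀r₁ _) (cong (r₀ ∘ r₁) (r₀-invol x)))) (same 2F)

  ~ᶠ⇒faceFlag : ∀ {x y} → x ~ᶠ y → FaceFlag x y
  ~ᶠ⇒faceFlag p = go (same 0F) p
    where
    go : ∀ {x y z} → FaceFlag x y → y ~ᶠ z → FaceFlag x z
    go q ε               = q
    go q (inj₁ refl ◅ p) = go (faceFlag-r₀ q) p
    go q (inj₂ refl ◅ p) = go (faceFlag-r₁ q) p

  data FaceEdge (x y : Flag) : Set where
    edge₀ : x ~ᵉ y           → FaceEdge x y
    edge₁ : r₁ x ~ᵉ y        → FaceEdge x y
    edge₂ : r₁ (r₀ x) ~ᵉ y   → FaceEdge x y

  ~ᶠ⇒faceEdge : ∀ {x y} → x ~ᶠ y → FaceEdge x y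
  ~ᶠ⇒faceEdge p with ~ᶠ⇒faceFlag p
  ... | same 0F     = edge₀ ε
  ... | same 1F     = edge₁ ε
  ... | same 2F     = edge₁ r₀-~ᵉ
  ... | opposite 0F = edge₀ r₀-~ᵉ
  ... | opposite 1F = edge₂ ε
  ... | opposite 2F = edge₂ r₀-~ᵉ

  -- The edge of `r₁ (r₀ x)` joins these two corners.
  third-side-not-loop : ∀ x → ¬ (r₀ x ~ᵛ r₀ (r₁ x))
  third-side-not-loop x p = no-loops (r₁ (r₀ x))
    (~ᵛ-sym r₁-~ᵛ ◅◅ p ◅◅ r₁-~ᵛ ◅◅ ≡⇒~ᵛ (r₁r₀r₁ x))

  face-vertices-distinct : ∀ x → ¬ (x ~ᵛ r₀ (r₁ x))
  face-vertices-distinct x p = no-loops (r₁ x) (~ᵛ-sym r₁-~ᵛ ◅◅ p)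

  face-edges-distinct : ∀ x → ¬ (x ~ᵉ r₁ x)
  face-edges-distinct x p =
    third-side-not-loop x (sameDart⇒~ᵛ (sameDart-r₀ (sameVertex⇒sameDart simple r₁-~ᵛ p)))

  -- If `r₂ x` were one of the six flags of the face of `x`, then `r₂` would fix `x`, or two sides
  -- or two corners of the triangle would coincide.
  edge-sides-distinct : ∀ x → ¬ (x ~ᶠ r₂ x)
  edge-sides-distinct x p = go (~ᶠ⇒faceFlag p) refl
    where
    go : ∀ {y} → FaceFlag x y → y ≢ r₂ x
    go (same 0F) q = r₂-free x (sym q)
    go (same 1F) q = face-edges-distinct x (r₂-~ᵉ ◅◅ ≡⇒~ᵉ (sym q))
    go (same 2F) q = face-vertices-distinct x (r₂-~ᵛ ◅◅ ≡⇒~ᵛ (sym q))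
    go (opposite 0F) q = no-loops x (r₂-~ᵛ ◅◅ ≡⇒~ᵛ (sym q))
    go (opposite 1F) q = no-loops x (r₂-~ᵛ ◅◅ ≡⇒~ᵛ (sym q) ◅◅ ~ᵛ-sym r₁-~ᵛ)
    go (opposite 2F) q = face-vertices-distinct x
      (r₂-~ᵛ ◅◅ ≡⇒~ᵛ (sym q) ◅◅ r₁-~ᵛ ◅◅
       ≡⇒~ᵛ (trans (r₁r₀r₁ (r₀ x)) (cong (r₀ ∘ r₁) (r₀-invol x))))

  face-edges-meet : ∀ {x y} → x ~ᶠ y → ∃ λ v → v ∈ᵉ x × v ∈ᵉ y
  face-edges-meet {x} p with ~ᶠ⇒faceEdge p
  ... | edge₀ q = x , (x , ε , ε) , (x , ε , q)
  ... | edge₁ q = x , (x , ε , ε) , (r₁ x , ~ᵛ-sym r₁-~ᵛ , q)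
  ... | edge₂ q = r₀ x , (r₀ x , ε , ~ᵉ-sym r₀-~ᵉ) , (r₁ (r₀ x) , ~ᵛ-sym r₁-~ᵛ , q)

-- Zigzags

module Zigzags (Γ : Triangulation) where
  open Triangulation Γ
  open MapProperties map
  open TriangulationProperties Γ

  private
    infix 4 _≋_
    _≋_ : EdgeSeq Γ → EdgeSeq Γ → Set
    _≋_ = _≈_ Γ

  ≈-sym : ∀ {z w} → z ≋ w → w ≋ z
  ≈-sym p i = ~ᵉ-sym (p i)

  ≈-trans : ∀ {z w u} → z ≋ w → w ≋ u → z ≋ u
  ≈-trans p q i = p i ◅◅ q i

  -- If a zigzag passes from the edge of x to that of r₁ x inside the face of
  -- x, it next passes from the edge of next x inside the face of next x.
  next : Flag → Flag
  next x = r₀ (r₂ (r₁ x))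

  zig : Flag → EdgeSeq Γ
  zig = iterate next

  r₁-~ᵉ-next : ∀ {x} → r₁ x ~ᵉ next x
  r₁-~ᵉ-next = inj₂ refl ◅ inj₁ refl ◅ ε

  next-injective : Injective _≡_ _≡_ next
  next-injective = r₁-injective ∘ r₂-injective ∘ r₀-injective

  r₀r₂-invol : ∀ x → r₀ (r₂ (r₀ (r₂ x))) ≡ x
  r₀r₂-invol x = trans (cong (r₀ ∘ r₂) (r₀r₂-comm x)) (trans (cong r₀ (r₂-invol _)) (r₀-invol x))

  -- The map `r₀ ∘ r₂` turns the traversal round: it conjugates `next` to its inverse.
  reverse-next : ∀ x → next (r₀ (r₂ (next x))) ≡ r₀ (r₂ x)
  reverse-next x = cong (r₀ ∘ r₂) (trans (cong r₁ (r₀r₂-invol (r₁ x))) (r₁-invol x))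

  reverse-iterate : ∀ x i → iterate next (r₀ (r₂ (iterate next x i))) i ≡ r₀ (r₂ x)
  reverse-iterate x zero    = refl
  reverse-iterate x (suc i) = begin
    iterate next (next (r₀ (r₂ (iterate next (next x) i)))) i   ≡⟨ iterate-comm next _ i ⟩
    next (iterate next (r₀ (r₂ (iterate next (next x) i))) i)   ≡⟨ cong next (reverse-iterate (next x) i) ⟩
    next (r₀ (r₂ (next x)))                                     ≡⟨ reverse-next x ⟩
    r₀ (r₂ x)                                                   ∎
    where open ≡-Reasoning

  zig-reverse : ∀ {x} n → iterate next x n ≡ x →
                ∀ i → i ≤ n → zig (r₀ (r₂ x)) i ~ᵉ zig x (n ∸ i)
  zig-reverse {x} n period i i≤n =
    ≡⇒~ᵉ (trans (cong (λ y → zig (r₀ (r₂ y)) i) (sym eq)) (reverse-iterate (zig x (n ∸ i)) i))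
    ◅◅ ~ᵉ-sym (inj₂ refl ◅ inj₁ refl ◅ ε)
    where
    eq : iterate next (iterate next x (n ∸ i)) i ≡ x
    eq = trans (sym (iterate-+ next x (n ∸ i) i))
               (trans (cong (iterate next x) (ℕ.m∸n+n≡m i≤n)) period)

  zig-period : ∀ {x} n → iterate next x n ≡ x → HasPeriod Γ (zig x) n
  zig-period {x} n period i =
    ≡⇒~ᵉ (trans (iterate-+ next x n i) (cong (λ y → zig y i) period))

  reverse-period : ∀ {x} n → iterate next x n ≡ x →
                   iterate next (r₀ (r₂ x)) n ≡ r₀ (r₂ x)
  reverse-period {x} n period =
    trans (cong (λ y → iterate next (r₀ (r₂ y)) n) (sym period)) (reverse-iterate x n)

  zig-reversal : ∀ x → IsReversal Γ (zig x) (zig (r₀ (r₂ x)))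
  zig-reversal x with n , period ← Finite.finite-order (proj₂ finite) next-injective x =
    suc n , ℕ.z<s , zig-period (suc n) period
    , zig-period (suc n) (reverse-period (suc n) period) , zig-reverse (suc n) period

  isZigzag-suc : ∀ {z} → IsZigzag Γ z → IsZigzag Γ (z ∘ suc)
  isZigzag-suc zz = record { turn = turn ∘ suc ; zigzag = zigzag ∘ suc }
    where open IsZigzag zz

  isZigzag-resp-≈ : ∀ {z w} → z ≋ w → IsZigzag Γ z → IsZigzag Γ w
  isZigzag-resp-≈ {z} {w} z≈w zz = record
    { turn = λ i → let f , g , d , d′ , f≁g = turn i in
        f , g , sides i (1 + i) d , sides (1 + i) (2 + i) d′ , f≁g
    ; zigzag = λ i v p q → zigzag i v
        (∈ᵉ-resp-~ᵉ (~ᵉ-sym (z≈w i)) p) (∈ᵉ-resp-~ᵉ (~ᵉ-sym (z≈w (2 + i))) q) }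
    where
    open IsZigzag zz
    sides : ∀ {f} i j → DistinctEdgesOf Γ f (z i) (z j) → DistinctEdgesOf Γ f (w i) (w j)
    sides i j ((x , x~zᵢ , x~f) , (y , y~zⱼ , y~f) , z≁z) =
      (x , x~zᵢ ◅◅ z≈w i , x~f) , (y , y~zⱼ ◅◅ z≈w j , y~f)
      , λ p → z≁z (z≈w i ◅◅ p ◅◅ ~ᵉ-sym (z≈w j))

  -- The edge `z 2` is a side of one of the two faces at the edge of `r₁ x`. In the face of `x`
  -- every side meets `z 0`. In the other face the side at the vertex of `x` meets `z 0` too, which
  -- leaves one possibility.
  zigzag-step : ∀ {z x} → IsZigzag Γ z → z 0 ~ᵉ x → z 1 ~ᵉ r₁ x → z 2 ~ᵉ r₁ (next x)
  zigzag-step {z} {x} zz z₀~x z₁~r₁x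
    with f , g , _ , ((p , p~z₁ , p~g) , (q , q~z₂ , q~g) , z₁≁z₂) , _ ← IsZigzag.turn zz 0
    = go (~ᵉ⇒sameDart (~ᵉ-sym (p~z₁ ◅◅ z₁~r₁x)))
    where
    p~q : p ~ᶠ q
    p~q = p~g ◅◅ ~ᶠ-sym q~g

    disjoint : ∀ {v} → v ∈ᵉ x → v ∈ᵉ q → ⊥
    disjoint v∈x v∈q = IsZigzag.zigzag zz 0 _
      (∈ᵉ-resp-~ᵉ (~ᵉ-sym z₀~x) v∈x) (∈ᵉ-resp-~ᵉ q~z₂ v∈q)

    same-face : ¬ (x ~ᶠ q)
    same-face s with v , v∈x , v∈q ← face-edges-meet s = disjoint v∈x v∈q

    next-face : r₂ (r₁ x) ~ᶠ q → z 2 ~ᵉ r₁ (next x)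
    next-face s with ~ᶠ⇒faceEdge s
    ... | edge₀ e = contradiction (z₁~r₁x ◅◅ r₂-~ᵉ ◅◅ e ◅◅ q~z₂) z₁≁z₂
    ... | edge₁ e = contradiction
      (r₁ (r₂ (r₁ x)) , ~ᵛ-sym (r₁-~ᵛ ◅◅ r₂-~ᵛ ◅◅ r₁-~ᵛ) , e) (disjoint (x , ε , ε))
    ... | edge₂ e = ~ᵉ-sym (e ◅◅ q~z₂)

    go : SameDart (r₁ x) p ⊎ SameDart (r₀ (r₁ x)) p → z 2 ~ᵉ r₁ (next x)
    go (inj₁ (inj₁ refl)) = contradiction (r₁-~ᶠ ◅◅ p~q) same-face
    go (inj₁ (inj₂ refl)) = next-face p~q
    go (inj₂ (inj₁ refl)) = contradiction (r₁-~ᶠ ◅◅ r₀-~ᶠ ◅◅ p~q) same-face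
    go (inj₂ (inj₂ refl)) = next-face
      (r₀-~ᶠ ◅◅ subst (_~ᶠ q) (sym (r₀r₂-comm (r₁ x))) p~q)

  zigzag-follow : ∀ {z x} → IsZigzag Γ z → z 0 ~ᵉ x → z 1 ~ᵉ r₁ x → z ≋ zig x
  zigzag-follow zz z₀ z₁ zero    = z₀
  zigzag-follow zz z₀ z₁ (suc i) =
    zigzag-follow (isZigzag-suc zz) (z₁ ◅◅ r₁-~ᵉ-next) (zigzag-step zz z₀ z₁) i

  -- The orbit starts at the flag of `z 0` that lies in the face of the first turn, at the corner
  -- shared with `z 1`.
  zigzag⇒zig : ∀ {z} → IsZigzag Γ z → ∃ λ x → z ≋ zig x
  zigzag⇒zig zz
    with _ , _ , ((p , p~z₀ , p~f) , (q , q~z₁ , q~f) , z₀≁z₁) , _ ← IsZigzag.turn zz 0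
    with ~ᶠ⇒faceEdge (p~f ◅◅ ~ᶠ-sym q~f)
  ... | edge₀ e = contradiction (~ᵉ-sym p~z₀ ◅◅ e ◅◅ q~z₁) z₀≁z₁
  ... | edge₁ e = p , zigzag-follow zz (~ᵉ-sym p~z₀) (~ᵉ-sym (e ◅◅ q~z₁))
  ... | edge₂ e = r₀ p , zigzag-follow zz (~ᵉ-sym p~z₀ ◅◅ r₀-~ᵉ) (~ᵉ-sym (e ◅◅ q~z₁))

  passes-r₂ : ∀ {z x} → Passes Γ z x → Passes Γ z (r₂ x)
  passes-r₂ {x = x} (z₁~x , (a , a~x , a∈z₀) , (b , b~r₀x , b∈z₂)) =
    z₁~x ◅◅ r₂-~ᵉ , (a , a~x ◅◅ r₂-~ᵛ , a∈z₀)
    , (b , b~r₀x ◅◅ r₂-~ᵛ ◅◅ ≡⇒~ᵛ (sym (r₀r₂-comm x)) , b∈z₂)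

  zig-passes : ∀ x → Passes Γ (zig (r₁ x)) x
  zig-passes x =
    ~ᵉ-sym (subst (_~ᵉ next (r₁ x)) (r₁-invol x) r₁-~ᵉ-next)
    , (r₁ x , ~ᵛ-sym r₁-~ᵛ , ε)
    , (r₁ (next (r₁ x))
      , ~ᵛ-sym (subst (λ y → r₀ x ~ᵛ r₁ (r₀ (r₂ y))) (sym (r₁-invol x))
          (r₂-~ᵛ ◅◅ ≡⇒~ᵛ (sym (r₀r₂-comm x)) ◅◅ r₁-~ᵛ))
      , r₁-~ᵉ-next)

  zig-passes-r₂ : ∀ x → Passes Γ (zig (r₁ (r₂ x))) x
  zig-passes-r₂ x = subst (Passes Γ z) (r₂-invol x) (passes-r₂ {z} (zig-passes (r₂ x)))
    where
    z : EdgeSeq Γ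
    z = zig (r₁ (r₂ x))

  -- A passage in the direction of `x` comes from one of the two faces at this edge, the face of `x`
  -- or that of `r₂ x`. The opposite direction would identify two corners of the face of `y`.
  passes⇒flag : ∀ {z x y} → z ≋ zig y → Passes Γ z x → y ≡ r₁ x ⊎ y ≡ r₁ (r₂ x)
  passes⇒flag {x = x} {y} z≈y (z₁~x , x∈z₀ , _)
    with ~ᵉ⇒sameDart (r₁-~ᵉ-next ◅◅ ~ᵉ-sym (z≈y 1) ◅◅ z₁~x)
  ... | inj₁ (inj₁ refl) = inj₁ (sym (r₁-invol y))
  ... | inj₁ (inj₂ refl) =
    inj₂ (trans (sym (r₁-invol y)) (cong r₁ (sym (r₂-invol (r₁ y)))))
  ... | inj₂ d with ∈ᵉ⇒~ᵛ (∈ᵉ-resp-~ᵉ (z≈y 0) x∈z₀)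
  ...   | inj₁ s = contradiction (~ᵛ-sym s ◅◅ ~ᵛ-sym (sameDart⇒~ᵛ d)) (face-vertices-distinct y)
  ...   | inj₂ s = contradiction (~ᵛ-sym s ◅◅ ~ᵛ-sym (sameDart⇒~ᵛ d)) (third-side-not-loop y)

  -- The vertex of x lies on exactly two edges.
  Degree2 : Flag → Set
  Degree2 x = r₁ (r₂ (r₁ x)) ≡ r₂ x

  degree2-r₁ : ∀ {x} → Degree2 x → Degree2 (r₁ x)
  degree2-r₁ {x} p = begin
    r₁ (r₂ (r₁ (r₁ x)))   ≡⟨ cong (r₁ ∘ r₂) (r₁-invol x) ⟩
    r₁ (r₂ x)             ≡⟨ cong r₁ p ⟨
    r₁ (r₁ (r₂ (r₁ x)))   ≡⟨ r₁-invol _ ⟩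
    r₂ (r₁ x)             ∎
    where open ≡-Reasoning

  degree2-r₂ : ∀ {x} → Degree2 x → Degree2 (r₂ x)
  degree2-r₂ {x} p = begin
    r₁ (r₂ (r₁ (r₂ x)))             ≡⟨ cong (r₁ ∘ r₂ ∘ r₁) p ⟨
    r₁ (r₂ (r₁ (r₁ (r₂ (r₁ x)))))   ≡⟨ cong (r₁ ∘ r₂) (r₁-invol _) ⟩
    r₁ (r₂ (r₂ (r₁ x)))             ≡⟨ cong r₁ (r₂-invol _) ⟩
    r₁ (r₁ x)                       ≡⟨ r₁-invol x ⟩
    x                               ≡⟨ r₂-invol x ⟨
    r₂ (r₂ x)                       ∎
    where open ≡-Reasoning

  -- The two faces at a vertex of degree 2 have their third edge in common.
  degree2-r₀ : ∀ {x} → Degree2 x → Degree2 (r₀ x)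
  degree2-r₀ {x} p with sameVertex⇒sameDart simple u~u′ (no-multiedges u u′ u~u′ tips)
    where
    u u′ : Flag
    u  = r₁ (r₀ x)
    u′ = r₁ (r₀ (r₂ x))

    u~u′ : u ~ᵛ u′
    u~u′ = ~ᵛ-sym r₁-~ᵛ ◅◅ r₂-~ᵛ ◅◅ ≡⇒~ᵛ (sym (r₀r₂-comm x)) ◅◅ r₁-~ᵛ

    r₁r₂x : r₁ (r₂ x) ≡ r₂ (r₁ x)
    r₁r₂x = trans (cong r₁ (sym p)) (r₁-invol _)

    tips : r₀ u ~ᵛ r₀ u′
    tips = ≡⇒~ᵛ (sym (r₁r₀r₁ x)) ◅◅ ~ᵛ-sym r₁-~ᵛ ◅◅ r₂-~ᵛ
        ◅◅ ≡⇒~ᵛ (trans (sym (r₀r₂-comm (r₁ x))) (cong r₀ (sym r₁r₂x)))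
        ◅◅ r₁-~ᵛ ◅◅ ≡⇒~ᵛ (r₁r₀r₁ (r₂ x))
  ... | inj₁ q = contradiction
    (subst (x ~ᶠ_) (r₀-injective (r₁-injective q)) ε) (edge-sides-distinct x)
  ... | inj₂ q = trans (cong r₁ q) (trans (r₁-invol _) (r₀r₂-comm x))

  degree2-~ᶠ : ∀ {x y} → x ~ᶠ y → Degree2 x → Degree2 y
  degree2-~ᶠ ε p = p
  degree2-~ᶠ (inj₁ refl ◅ s) p = degree2-~ᶠ s (degree2-r₀ p)
  degree2-~ᶠ (inj₂ refl ◅ s) p = degree2-~ᶠ s (degree2-r₁ p)

  degree2-~ᵉ : ∀ {x y} → x ~ᵉ y → Degree2 x → Degree2 y
  degree2-~ᵉ ε p = p
  degree2-~ᵉ (inj₁ refl ◅ s) p = degree2-~ᵉ s (degree2-r₀ p)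
  degree2-~ᵉ (inj₂ refl ◅ s) p = degree2-~ᵉ s (degree2-r₂ p)

  -- Both flags lie at the third corner of the face across the edge of `r₁ x`.
  next-tip : ∀ x → r₀ (r₁ (r₂ (r₁ x))) ~ᵛ r₀ (r₁ (next x))
  next-tip x = r₁-~ᵛ ◅◅ ≡⇒~ᵛ (r₁r₀r₁ (r₂ (r₁ x)))

  -- The two faces at a vertex of degree 2 have the same corners, so `z 0` and `z 2` would meet at
  -- the vertex of `r₀ x`.
  zigzag⇒¬degree2 : ∀ {z} → IsZigzag Γ z → ¬ Degree2 (z 0)
  zigzag⇒¬degree2 {z} zz p with x , z≈x ← zigzag⇒zig zz =
    IsZigzag.zigzag zz 0 (r₀ x)
      (r₀ x , ε , ~ᵉ-sym (z≈x 0 ◅◅ r₀-~ᵉ))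
      (r₀ (r₁ (next x)) , ~ᵛ-sym tip , ~ᵉ-sym r₀-~ᵉ ◅◅ r₁-~ᵉ-next ◅◅ ~ᵉ-sym (z≈x 2))
    where
    tip : r₀ x ~ᵛ r₀ (r₁ (next x))
    tip = r₂-~ᵛ
      ◅◅ ≡⇒~ᵛ (trans (sym (r₀r₂-comm x)) (cong r₀ (sym (degree2-~ᵉ (z≈x 0) p))))
      ◅◅ next-tip x

  module _ (¬degree2 : ∀ x → ¬ Degree2 x) where

    private
      disjoint : ∀ x v → v ∈ᵉ x → ¬ (v ∈ᵉ next (next x))
      disjoint x v v∈x v∈w
        with ∈ᵉ⇒~ᵛ v∈x | ∈ᵉ⇒~ᵛ (∈ᵉ-resp-~ᵉ (~ᵉ-sym (r₁-~ᵉ-next {next x})) v∈w)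
      ... | inj₁ p | inj₁ q = no-loops (r₂ (r₁ x))
        (~ᵛ-sym (r₁-~ᵛ ◅◅ r₂-~ᵛ) ◅◅ ~ᵛ-sym p ◅◅ q ◅◅ ~ᵛ-sym r₁-~ᵛ)
      ... | inj₁ p | inj₂ q = third-side-not-loop (next x)
        (≡⇒~ᵛ (r₀-invol _) ◅◅ ~ᵛ-sym (r₁-~ᵛ ◅◅ r₂-~ᵛ) ◅◅ ~ᵛ-sym p ◅◅ q)
      ... | inj₂ p | inj₁ q = third-side-not-loop x
        (~ᵛ-sym p ◅◅ q ◅◅ ~ᵛ-sym r₁-~ᵛ ◅◅ ≡⇒~ᵛ (r₀r₂-comm (r₁ x)) ◅◅ ~ᵛ-sym r₂-~ᵛ)
      -- Here the far corners of the two consecutive faces coincide. By simplicity so do the edges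
      -- that join them to the vertex of `x`, which then has degree 2.
      ... | inj₂ p | inj₂ q
        with sameVertex⇒sameDart simple x~y
               (no-multiedges x y x~y (~ᵛ-sym p ◅◅ q ◅◅ ~ᵛ-sym (next-tip x)))
        where
        y : Flag
        y = r₁ (r₂ (r₁ x))
        x~y : x ~ᵛ y
        x~y = r₁-~ᵛ ◅◅ r₂-~ᵛ ◅◅ r₁-~ᵛ
      ...   | inj₁ e = r₂-free (r₁ x) (r₁-injective (trans (sym e) (sym (r₁-invol x))))
      ...   | inj₂ e = ¬degree2 x (sym e)

      next-side : ∀ x → DistinctEdgesOf Γ x x (next x)
      next-side x = (x , ε , ε) , (r₁ x , r₁-~ᵉ-next , ~ᶠ-sym r₁-~ᶠ)
                  , λ p → face-edges-distinct x (p ◅◅ ~ᵉ-sym r₁-~ᵉ-next)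

      next-face : ∀ x → ¬ (x ~ᶠ next x)
      next-face x p = edge-sides-distinct (r₁ x) (~ᶠ-sym r₁-~ᶠ ◅◅ p ◅◅ ~ᶠ-sym r₀-~ᶠ)

    zig-isZigzag : ∀ x → IsZigzag Γ (zig x)
    zig-isZigzag x = record { turn = turns x ; zigzag = zigzags x }
      where
      turns : ∀ x i → ∃₂ λ f g →
              DistinctEdgesOf Γ f (zig x i) (zig x (1 + i)) ×
              DistinctEdgesOf Γ g (zig x (1 + i)) (zig x (2 + i)) × ¬ (f ~ᶠ g)
      turns x zero    = x , next x , next-side x , next-side (next x) , next-face x
      turns x (suc i) = turns (next x) i

      zigzags : ∀ x i v → v ∈ᵉ zig x i → ¬ (v ∈ᵉ zig x (2 + i))
      zigzags x zero    = disjoint x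
      zigzags x (suc i) = zigzags (next x) i

    -- The first two edges determine the vertex they share. A second face with the same two edges at
    -- this vertex would give it degree 2.
    zig-injective : ∀ {x y} → zig x ≋ zig y → x ≡ y
    zig-injective {x} {y} p with ~ᵉ⇒sameDart (p 0)
      | r₁-~ᵉ-next {x} ◅◅ p 1 ◅◅ ~ᵉ-sym (r₁-~ᵉ-next {y})
    ... | inj₁ (inj₁ refl) | _ = refl
    ... | inj₁ (inj₂ refl) | q
      with sameVertex⇒sameDart simple (~ᵛ-sym r₁-~ᵛ ◅◅ r₂-~ᵛ ◅◅ r₁-~ᵛ) q
    ...   | inj₁ e = contradiction (sym (r₁-injective e)) (r₂-free x)
    ...   | inj₂ e = contradiction
      (trans (cong r₁ e) (r₁-invol _)) (¬degree2 x)
    zig-injective {x} {y} p | inj₂ d | q with ~ᵉ⇒sameDart q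
    ... | inj₁ e = contradiction
      (r₁-~ᵛ ◅◅ sameDart⇒~ᵛ e ◅◅ ~ᵛ-sym r₁-~ᵛ ◅◅ ~ᵛ-sym (sameDart⇒~ᵛ d)) (no-loops x)
    ... | inj₂ e = contradiction
      (sameDart⇒~ᵛ d ◅◅ r₁-~ᵛ ◅◅ ~ᵛ-sym (sameDart⇒~ᵛ e)) (third-side-not-loop x)

    -- A reversal w of z = zig x runs through the edges z n , … , z 0, hence is
    -- determined by them.
    reversal⇒zig : ∀ {z w x} → z ≋ zig x → IsReversal Γ z w → w ≋ zig (r₀ (r₂ x))
    reversal⇒zig {z} {w} {x} z≈x (suc n , _ , zⁿ , wⁿ , w≈z) = agree
      where
      -- The edges determine the starting flag, so a period of the edges is a period of the flags.
      period : iterate next x (suc n) ≡ x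
      period = zig-injective λ i →
        ≡⇒~ᵉ (sym (iterate-+ next x (suc n) i)) ◅◅ ~ᵉ-sym (z≈x _) ◅◅ zⁿ i ◅◅ z≈x i

      u : EdgeSeq Γ
      u = zig (r₀ (r₂ x))

      uⁿ : HasPeriod Γ u (suc n)
      uⁿ = zig-period (suc n) (reverse-period (suc n) period)

      agree-below : ∀ i → i ≤ suc n → w i ~ᵉ u i
      agree-below i i≤n = w≈z i i≤n ◅◅ z≈x _ ◅◅ ~ᵉ-sym (zig-reverse (suc n) period i i≤n)

      agree-+ : ∀ k i → i ≤ suc n → w (k * suc n + i) ~ᵉ u (k * suc n + i)
      agree-+ zero    i i≤n = agree-below i i≤n
      agree-+ (suc k) i i≤n =
        subst (λ j → w j ~ᵉ u j) (sym (ℕ.+-assoc (suc n) (k * suc n) i))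
          (wⁿ _ ◅◅ agree-+ k i i≤n ◅◅ ~ᵉ-sym (uⁿ _))

      agree : w ≋ u
      agree i = subst (λ j → w j ~ᵉ u j)
        (trans (ℕ.+-comm (i / suc n * suc n) (i % suc n)) (sym (m≡m%n+[m/n]*n i (suc n))))
        (agree-+ (i / suc n) (i % suc n) (ℕ.<⇒≤ (m%n<n i (suc n))))

-- z-orientations

module ZOrientations (Γ : Triangulation) (¬degree2 : ∀ x → ¬ Zigzags.Degree2 Γ x) where
  open Triangulation Γ
  open MapProperties map
  open Zigzags Γ

  record IsSign (sign : Flag → Bool) : Set where
    field
      sign-r₁   : ∀ x → sign (r₁ x) ≡ not (sign x)
      sign-r₀r₂ : ∀ x → sign (r₀ (r₂ x)) ≡ not (sign x)

    sign-r₀ : ∀ x → sign (r₀ x) ≡ not (sign (r₂ x))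
    sign-r₀ x = trans (cong (sign ∘ r₀) (sym (r₂-invol x))) (sign-r₀r₂ (r₂ x))

    sign-r₂r₀ : ∀ x → sign (r₂ (r₀ x)) ≡ not (sign x)
    sign-r₂r₀ x = trans (cong sign (sym (r₀r₂-comm x))) (sign-r₀r₂ x)

    sign-next : ∀ x → sign (next x) ≡ sign x
    sign-next x = trans (sign-r₀r₂ (r₁ x)) (trans (cong not (sign-r₁ x)) (not-involutive _))

    typeII-~ᵉ : ∀ {x y} → x ~ᵉ y → sign (r₂ x) ≡ sign x → sign (r₂ y) ≡ sign y
    typeII-~ᵉ ε p = p
    typeII-~ᵉ {x} (inj₁ refl ◅ q) p = typeII-~ᵉ q
      (trans (sign-r₂r₀ x) (trans (cong not (sym p)) (sym (sign-r₀ x))))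
    typeII-~ᵉ {x} (inj₂ refl ◅ q) p = typeII-~ᵉ q
      (trans (cong sign (r₂-invol x)) (sym p))

    typeI-~ᵉ : ∀ {x y} → x ~ᵉ y → sign (r₂ x) ≡ not (sign x) → sign (r₂ y) ≡ not (sign y)
    typeI-~ᵉ ε p = p
    typeI-~ᵉ {x} (inj₁ refl ◅ q) p = typeI-~ᵉ q
      (trans (sign-r₂r₀ x) (cong not (trans (sym (not-involutive _))
        (trans (cong not (sym p)) (sym (sign-r₀ x))))))
    typeI-~ᵉ {x} (inj₂ refl ◅ q) p = typeI-~ᵉ q
      (trans (cong sign (r₂-invol x)) (trans (sym (not-involutive _)) (cong not (sym p))))

  -- Then sign x ≡ true means that zig (r₁ x), which passes through the edge of x
  -- away from the vertex of x, belongs to τ.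
  Encodes : (Flag → Bool) → ZOrientation Γ → Set
  Encodes sign τ = ∀ x → sign x ≡ false ⇔ ZOrientation._∈τ τ (zig x)

  module _ {sign : Flag → Bool} (isSign : IsSign sign) where
    open IsSign isSign

    InSign : EdgeSeq Γ → Set
    InSign z = ∃ λ x → _≈_ Γ z (zig x) × sign x ≡ false

    -- The flag that represents a zigzag is unique, so any representative can be tested in place of
    -- the one stored in `InSign`.
    inSign⇒sign : ∀ {z x} → _≈_ Γ z (zig x) → InSign z → sign x ≡ false
    inSign⇒sign z≈x (y , z≈y , p) =
      trans (cong sign (zig-injective ¬degree2 (≈-trans (≈-sym z≈x) z≈y))) p

    signed : ZOrientation Γ
    signed = record
      { _∈τ     = InSign
      ; zigzags = λ (x , z≈x , _) → isZigzag-resp-≈ (≈-sym z≈x) (zig-isZigzag ¬degree2 x)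
      ; resp-≈  = λ z≈w (x , z≈x , p) → x , ≈-trans (≈-sym z≈w) z≈x , p
      ; cyclic  = cyclic
      ; choice  = choice }
      where
      cyclic : ∀ {z} → IsZigzag Γ z → InSign z ⇔ InSign (z ∘ suc)
      cyclic zz with x , z≈x ← zigzag⇒zig zz = mk⇔
        (λ s → next x , z≈x ∘ suc , trans (sign-next x) (inSign⇒sign z≈x s))
        (λ s → x , z≈x , trans (sym (sign-next x)) (inSign⇒sign (z≈x ∘ suc) s))

      choice : ∀ {z w} → IsZigzag Γ z → IsReversal Γ z w →
               (InSign z ⊎ InSign w) × ¬ (InSign z × InSign w)
      choice {z} {w} zz rev with x , z≈x ← zigzag⇒zig zz = either , not-both
        where
        w≈x : _≈_ Γ w (zig (r₀ (r₂ x)))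
        w≈x = reversal⇒zig ¬degree2 z≈x rev

        either : InSign z ⊎ InSign w
        either with sign x in p
        ... | false = inj₁ (x , z≈x , p)
        ... | true  = inj₂ (_ , w≈x , trans (sign-r₀r₂ x) (cong not p))

        not-both : ¬ (InSign z × InSign w)
        not-both (s , t) = not-¬ (inSign⇒sign z≈x s)
          (trans (sym (not-involutive _))
                 (cong not (trans (sym (sign-r₀r₂ x)) (inSign⇒sign w≈x t))))

    signed-encodes : Encodes sign signed
    signed-encodes x = mk⇔ (λ p → x , (λ _ → ε) , p) (inSign⇒sign (λ _ → ε))

  module _ (τ : ZOrientation Γ) where
    open ZOrientation τ

    private
      either : ∀ x → zig x ∈τ ⊎ zig (r₀ (r₂ x)) ∈τ
      either x = proj₁ (choice (zig-isZigzag ¬degree2 x) (zig-reversal x))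

      not-both : ∀ x → zig x ∈τ → ¬ (zig (r₀ (r₂ x)) ∈τ)
      not-both x p q = proj₂ (choice (zig-isZigzag ¬degree2 x) (zig-reversal x)) (p , q)

    abstract
      -- The disjunction in `choice` decides between `zig x` and its reversal; the colour records
      -- the answer.
      signOf : Flag → Bool
      signOf x = [ (λ _ → false) , (λ _ → true) ]′ (either x)

      encodes-signOf : Encodes signOf τ
      encodes-signOf x with either x
      ... | inj₁ p = mk⇔ (λ _ → p) (λ _ → refl)
      ... | inj₂ q = mk⇔ (λ ()) (λ p → contradiction q (not-both x p))

    module _ {sign : Flag → Bool} (enc : Encodes sign τ) where
      module Enc x = Equivalence (enc x)

      encodes⇒isSign : IsSign sign
      encodes⇒isSign = record { sign-r₁ = sign-r₁ ; sign-r₀r₂ = sign-r₀r₂ }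
        where
        sign-r₀r₂ : ∀ x → sign (r₀ (r₂ x)) ≡ not (sign x)
        sign-r₀r₂ x with sign x in p
        ... | false = ¬-not λ q → not-both x (Enc.to x p) (Enc.to (r₀ (r₂ x)) q)
        ... | true  = Enc.from _ ([ (λ q → contradiction (trans (sym p) (Enc.from x q)) λ ())
                                  , (λ q → q) ]′ (either x))

        sign-next : ∀ x → sign (next x) ≡ sign x
        sign-next x with sign x in p | sign (next x) in q
        ... | false | false = refl
        ... | true  | true  = refl
        ... | false | true  = trans (sym q) (Enc.from _
          (Equivalence.to (cyclic (zig-isZigzag ¬degree2 x)) (Enc.to x p)))
        ... | true  | false = trans (sym (Enc.from _
          (Equivalence.from (cyclic (zig-isZigzag ¬degree2 x)) (Enc.to (next x) q)))) p

        sign-r₁ : ∀ x → sign (r₁ x) ≡ not (sign x)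
        -- As `next x` is `r₀ (r₂ (r₁ x))`, invariance under the shift and the change under reversal
        -- combine to the rule for `r₁`.
        sign-r₁ x = trans (sym (not-involutive _))
          (cong not (trans (sym (sign-r₀r₂ (r₁ x))) (sign-next x)))

      open IsSign encodes⇒isSign

      sign⇒∈τ : ∀ {x} → sign x ≡ true → zig (r₁ x) ∈τ
      sign⇒∈τ {x} p = Enc.to (r₁ x) (trans (sign-r₁ x) (cong not p))

      ∈τ⇒sign : ∀ {z x} → z ∈τ → _≈_ Γ z (zig (r₁ x)) → sign x ≡ true
      ∈τ⇒sign {x = x} z∈τ z≈x =
        not-injective (trans (sym (sign-r₁ x)) (Enc.from (r₁ x) (resp-≈ z≈x z∈τ)))

      passage : ∀ {z x} → z ∈τ → Passes Γ z x →
                _≈_ Γ z (zig (r₁ x)) × sign x ≡ true ⊎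
                _≈_ Γ z (zig (r₁ (r₂ x))) × sign (r₂ x) ≡ true
      passage z∈τ pass with y , z≈y ← zigzag⇒zig (zigzags z∈τ) with passes⇒flag z≈y pass
      ... | inj₁ refl = inj₁ (z≈y , ∈τ⇒sign z∈τ z≈y)
      ... | inj₂ refl = inj₂ (z≈y , ∈τ⇒sign z∈τ z≈y)

      zig-r₁-distinct : ∀ {x y} → x ≢ y → ¬ (_≈_ Γ (zig (r₁ x)) (zig (r₁ y)))
      zig-r₁-distinct x≢y p = x≢y (r₁-injective (zig-injective ¬degree2 p))

      directedII⇔ : ∀ x → DirectedII Γ τ x ⇔ (sign x ≡ true × sign (r₂ x) ≡ true)
      directedII⇔ x = mk⇔ signs passages
        where
        signs : DirectedII Γ τ x → sign x ≡ true × sign (r₂ x) ≡ true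
        signs (z , w , z∈τ , w∈τ , z≉w , pz , pw) with passage z∈τ pz | passage w∈τ pw
        ... | inj₁ (_ , p)   | inj₂ (_ , q)   = p , q
        ... | inj₂ (_ , q)   | inj₁ (_ , p)   = p , q
        -- Two passages that come from the same face are the same sequence.
        ... | inj₁ (z≈x , _) | inj₁ (w≈x , _) = contradiction (≈-trans z≈x (≈-sym w≈x)) z≉w
        ... | inj₂ (z≈x , _) | inj₂ (w≈x , _) = contradiction (≈-trans z≈x (≈-sym w≈x)) z≉w

        passages : sign x ≡ true × sign (r₂ x) ≡ true → DirectedII Γ τ x
        passages (p , q) = _ , _ , sign⇒∈τ p , sign⇒∈τ q
          , zig-r₁-distinct (r₂-free x ∘ sym) , zig-passes x , zig-passes-r₂ x

      edgeI⇔ : ∀ x → EdgeI Γ τ x ⇔ (sign (r₂ x) ≡ not (sign x))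
      edgeI⇔ x = mk⇔ signs passages
        where
        signs : EdgeI Γ τ x → sign (r₂ x) ≡ not (sign x)
        signs (z , w , z∈τ , w∈τ , _ , pz , pw) with passage z∈τ pz | passage w∈τ pw
        ... | inj₁ (_ , p) | inj₁ (_ , q) =
          trans (not-injective (trans (sym (sign-r₀ x)) q)) (cong not (sym p))
        -- The flags `x` and `r₂ (r₀ x)` stand for mutually reverse passages, of which `τ` contains
        -- only one.
        ... | inj₁ (_ , p) | inj₂ (_ , q) =
          contradiction (trans (sym q) (sign-r₂r₀ x)) (not-¬ (sym p))
        ... | inj₂ (_ , p) | inj₁ (_ , q) =
          contradiction (trans (sym q) (sign-r₀ x)) (not-¬ (sym p))
        ... | inj₂ (_ , p) | inj₂ (_ , q) = trans p (sym (trans (sym (sign-r₂r₀ x)) q))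

        passages : sign (r₂ x) ≡ not (sign x) → EdgeI Γ τ x
        passages p with sign x in q
        ... | true = _ , _ , sign⇒∈τ q , sign⇒∈τ (trans (sign-r₀ x) (cong not p))
          , zig-r₁-distinct (r₀-free x ∘ sym) , zig-passes x , zig-passes (r₀ x)
        ... | false = _ , _ , sign⇒∈τ p , sign⇒∈τ (trans (sign-r₂r₀ x) (cong not q))
          , zig-r₁-distinct (r₀-free x ∘ sym ∘ r₂-injective)
          , zig-passes-r₂ x , zig-passes-r₂ (r₀ x)

      edgeII⇔ : ∀ x → EdgeII Γ τ x ⇔ (sign (r₂ x) ≡ sign x)
      edgeII⇔ x = mk⇔ signs directed
        where
        signs : EdgeII Γ τ x → sign (r₂ x) ≡ sign x
        signs (inj₁ d) with p , q ← Equivalence.to (directedII⇔ x) d = trans q (sym p)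
        signs (inj₂ d) with p , q ← Equivalence.to (directedII⇔ (r₀ x)) d =
          not-injective (trans (sym (sign-r₀ x)) (trans p (trans (sym q) (sign-r₂r₀ x))))

        directed : sign (r₂ x) ≡ sign x → EdgeII Γ τ x
        directed p with sign x in q
        ... | true  = inj₁ (Equivalence.from (directedII⇔ x) (q , p))
        ... | false = inj₂ (Equivalence.from (directedII⇔ (r₀ x))
          (trans (sign-r₀ x) (cong not p) , trans (sign-r₂r₀ x) (cong not q)))

-- The z-orientation of T(D)

module FromDigraph (D : EulerianEmbedding) where
  open EulerianEmbedding D
  open MapProperties map
  open OrientationProperties orientation

  Γ : Triangulation
  Γ = T embedding

  private
    module Γ where
      open Triangulation Γ public
      open MapProperties (Triangulation.map Γ) public

  open Zigzags Γ

  private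
    out-flip : ∀ x → out (r₁ x) ≡ not (out x)
    out-flip = out-r₁ directed-faces

    -- Equality would make this a vertex with a single edge end, but `r₁` reverses `out` and `r₂`
    -- preserves it.
    r₁≢r₂ : ∀ x → r₁ x ≢ r₂ x
    r₁≢r₂ x p = not-¬ refl
      (trans (sym (out-r₂ x)) (trans (cong out (sym p)) (out-flip x)))

    -- The two sides of a digon have the same ends, so they are one edge by simplicity, and a closed
    -- face does not repeat an edge.
    not-digon : ∀ x → r₀ (r₁ (r₀ x)) ≢ r₁ x
    not-digon x p with edge-once x y (r₀-~ᶠ ◅◅ r₁-~ᶠ)
        (r₀-~ᵉ ◅◅ no-multiedges (r₀ x) y r₁-~ᵛ
          (≡⇒~ᵛ (r₀-invol x) ◅◅ r₁-~ᵛ ◅◅ ≡⇒~ᵛ (sym p)))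
      where
      y : Flag
      y = r₁ (r₀ x)
    ... | inj₁ q = no-loops x (≡⇒~ᵛ (sym q) ◅◅ ~ᵛ-sym r₁-~ᵛ)
    ... | inj₂ q = r₁-free (r₀ x) q

  ¬degree2 : ∀ x → ¬ Degree2 x
  ¬degree2 (x , 0F) p = r₁≢r₂ x (cong proj₁ p)
  ¬degree2 (x , 1F) p = r₁≢r₂ x (sym (cong proj₁ p))
  ¬degree2 (x , 2F) p = not-digon x (cong proj₁ p)

  open ZOrientations Γ ¬degree2

  -- The directions prescribe the colours at `0F`. The rule for `r₁` then forces those at `1F`, and
  -- the rule for `r₀ r₂`, with directed faces, those at `2F`.
  sign : Γ.Flag → Bool
  sign (x , 0F) = out x
  sign (x , 1F) = not (out x)
  sign (x , 2F) = not (out x)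

  isSign : IsSign sign
  isSign = record
    { sign-r₁ = λ where
        (x , 0F) → refl
        (x , 1F) → sym (not-involutive _)
        (x , 2F) → cong not (out-r₀ x)
    ; sign-r₀r₂ = λ where
        (x , 0F) → trans (out-r₀ (r₂ x)) (cong not (out-r₂ x))
        (x , 1F) → cong not (out-flip x)
        (x , 2F) → cong not (out-flip x) }

  open IsSign isSign

  rim-typeII : ∀ x → sign (Γ.r₂ (x , 0F)) ≡ sign (x , 0F)
  rim-typeII = out-r₂

  spoke₁-typeI : ∀ x → sign (Γ.r₂ (x , 1F)) ≡ not (sign (x , 1F))
  spoke₁-typeI x = cong not (out-flip x)

  spoke₂-typeI : ∀ x → sign (Γ.r₂ (x , 2F)) ≡ not (sign (x , 2F))
  spoke₂-typeI x = cong not (out-flip x)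

  τ : ZOrientation Γ
  τ = signed isSign

  private
    encodes : Encodes sign τ
    encodes = signed-encodes isSign

    module I x = Equivalence (edgeI⇔ τ {sign} encodes x)
    module II x = Equivalence (edgeII⇔ τ {sign} encodes x)
    module Directed x = Equivalence (directedII⇔ τ {sign} encodes x)

  allFacesI : AllFacesI Γ τ
  allFacesI (x , i) = (x , 0F) , on-face i , II.from _ (rim-typeII x)
    , I.from _ (spoke₁-typeI x) , I.from _ (spoke₁-typeI (r₀ x))
    where
    on-face : ∀ i → (x , 0F) Γ.~ᶠ (x , i)
    on-face 0F = ε
    on-face 1F = Γ.r₁-~ᶠ
    on-face 2F = Γ.r₁-~ᶠ ◅◅ Γ.r₀-~ᶠ

  private
    -- `next` runs cyclically through the indices `0F`, `2F`, `1F`, so edges of the digraph occur at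
    -- every third place of a zigzag.
    reach-rim : ∀ p → ∃₂ λ c x → zig p c ≡ (x , 0F)
    reach-rim (x , 0F) = 0 , _ , refl
    reach-rim (x , 1F) = 1 , _ , refl
    reach-rim (x , 2F) = 2 , _ , refl

    -- With the factor 3 on the right, three applications of `next` unfold by computation in each
    -- step of the induction.
    next³-rim : ∀ k x → ∃ λ y → zig (x , 0F) (k * 3) ≡ (y , 0F)
    next³-rim zero    x = x , refl
    next³-rim (suc k) x = next³-rim k _

    rim-at : ∀ {p c x} → zig p c ≡ (x , 0F) →
             ∀ k → ∃ λ y → zig p (3 * k + c) ≡ (y , 0F)
    rim-at {p} {c} {x} start k with y , q ← next³-rim k x = y , (begin
      zig p (3 * k + c)       ≡⟨ cong (λ m → zig p (m + c)) (ℕ.*-comm 3 k) ⟩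
      zig p (k * 3 + c)       ≡⟨ cong (zig p) (ℕ.+-comm (k * 3) c) ⟩
      zig p (c + k * 3)       ≡⟨ iterate-+ next p c (k * 3) ⟩
      zig (zig p c) (k * 3)   ≡⟨ cong (λ q → zig q (k * 3)) start ⟩
      zig (x , 0F) (k * 3)    ≡⟨ q ⟩
      (y , 0F)                ∎)
      where open ≡-Reasoning

  allHomogeneous : AllHomogeneous Γ τ
  allHomogeneous z (p , z≈p , _) with c , _ , start ← reach-rim p = c , λ k →
    let j = 3 * k + c
        y , q₀ = rim-at start k
        q₁ = trans (iterate-comm next p j) (cong next q₀)
        q₂ = trans (iterate-comm next (next p) j) (cong next q₁)
        along : ∀ i {u} → zig p i ≡ u → u Γ.~ᵉ z i
        along = λ { i refl → Γ.~ᵉ-sym (z≈p i) }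
    in II.from _ (typeII-~ᵉ (along j q₀) (rim-typeII y))
     , I.from _ (typeI-~ᵉ (along (1 + j) q₁) (spoke₂-typeI _))
     , I.from _ (typeI-~ᵉ (along (2 + j) q₂) (spoke₁-typeI _))

  isΓII : IsΓII D Γ τ ≅-refl
  isΓII = record
    { vertices = λ v → mk⇔ (rim-vertex v)
        λ { (y , y~v) all-I → not-¬ (rim-typeII y) (I.to _ (all-I (y , 0F) y~v)) }
    ; edges = λ x → mk⇔ (λ d → rim-dart x (Directed.to x d)) λ where
        (y , p , inj₁ refl) → Directed.from _ (p , trans (out-r₂ y) p)
        (y , p , inj₂ refl) → Directed.from _
          (trans (out-r₂ y) p , trans (out-r₂ (r₂ y)) (trans (out-r₂ y) p)) }
    where
    -- All edges at the centre of a face are spokes, and spokes are of type I, so the centre is a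
    -- vertex of type I.
    hub-closed : ∀ {x u} → (x , 2F) Γ.~ᵛ u → ∃ λ y → u ≡ (y , 2F)
    hub-closed ε = _ , refl
    hub-closed (inj₁ refl ◅ s) = hub-closed s
    hub-closed (inj₂ refl ◅ s) = hub-closed s

    rim-vertex : ∀ v → VertexII Γ τ v → ∃ λ y → (y , 0F) Γ.~ᵛ v
    rim-vertex (x , 0F) _ = x , ε
    rim-vertex (x , 1F) _ = x , Γ.r₁-~ᵛ
    rim-vertex (x , 2F) h = contradiction
      (λ u u~x → let y , q = hub-closed (Γ.~ᵛ-sym u~x) in
        subst (EdgeI Γ τ) (sym q) (I.from _ (spoke₂-typeI y))) h

    rim-dart : ∀ x → sign x ≡ true × sign (Γ.r₂ x) ≡ true →
               ∃ λ y → out y ≡ true × Γ.SameDart (y , 0F) x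
    rim-dart (x , 0F) (p , _) = x , p , inj₁ refl
    rim-dart (x , 1F) (p , q) =
      contradiction (trans q (sym p)) λ e → not-¬ e (spoke₁-typeI x)
    rim-dart (x , 2F) (p , q) =
      contradiction (trans q (sym p)) λ e → not-¬ e (spoke₂-typeI x)

  -- Uniqueness of the z-orientation of T(D)

  module _ (τ′ : ZOrientation Γ) (Γ′-II : IsΓII D Γ τ′ ≅-refl) where
    private
      sign′ : Γ.Flag → Bool
      sign′ = signOf τ′

      enc′ : Encodes sign′ τ′
      enc′ = encodes-signOf τ′

      open IsSign (encodes⇒isSign τ′ enc′) using ()
        renaming (sign-r₁ to sign′-r₁; sign-r₀r₂ to sign′-r₀r₂; sign-r₂r₀ to sign′-r₂r₀)

      rim-signs : ∀ x → out x ≡ true →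
                  sign′ (x , 0F) ≡ true × sign′ (Γ.r₂ (x , 0F)) ≡ true
      rim-signs x p = Equivalence.to (directedII⇔ τ′ enc′ _)
        (Equivalence.from (IsΓII.edges Γ′-II _) (x , p , inj₁ refl))

      rim≡ : ∀ x → sign′ (x , 0F) ≡ out x
      rim≡ x with out x in p
      ... | true  = proj₁ (rim-signs x p)
      -- The edge leaves its other end, so both flags there have colour `true`; the rule for `r₂ r₀`
      -- carries this back to `x`.
      ... | false = not-injective (trans (sym (sign′-r₂r₀ (x , 0F)))
        (proj₂ (rim-signs (r₀ x) (trans (out-r₀ x) (cong not p)))))

      spoke₁≡ : ∀ x → sign′ (x , 1F) ≡ not (out x)
      spoke₁≡ x = trans (sign′-r₁ (x , 0F)) (cong not (rim≡ x))

      sign′≡sign : ∀ p → sign′ p ≡ sign p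
      sign′≡sign (x , 0F) = rim≡ x
      sign′≡sign (x , 1F) = spoke₁≡ x
      sign′≡sign (x , 2F) = begin
        sign′ (x , 2F)              ≡⟨ cong (λ y → sign′ (y , 2F)) (r₁-invol x) ⟨
        sign′ (r₁ (r₁ x) , 2F)      ≡⟨ sign′-r₀r₂ (r₁ x , 1F) ⟩
        not (sign′ (r₁ x , 1F))     ≡⟨ cong not (spoke₁≡ (r₁ x)) ⟩
        not (not (out (r₁ x)))      ≡⟨ not-involutive _ ⟩
        out (r₁ x)                  ≡⟨ out-flip x ⟩
        not (out x)                 ∎
        where open ≡-Reasoning

    unique : ∀ z → ZOrientation._∈τ τ z ⇔ ZOrientation._∈τ τ′ z
    unique z = mk⇔
      (λ (p , z≈p , q) → τ′.resp-≈ (≈-sym z≈p)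
        (Equivalence.to (enc′ p) (trans (sign′≡sign p) q)))
      (λ z∈τ′ → let p , z≈p = zigzag⇒zig (τ′.zigzags z∈τ′) in
        p , z≈p , trans (sym (sign′≡sign p))
                        (Equivalence.from (enc′ p) (τ′.resp-≈ z≈p z∈τ′)))
      where module τ′ = ZOrientation τ′

-- The digraph of the edges of type II

-- Degree 2 spreads from one corner over the whole face. But a face of type I has an edge that some
-- zigzag passes through, and such an edge has no end of degree 2.
allFacesI⇒¬degree2 : ∀ Γ τ → AllFacesI Γ τ → ∀ x → ¬ Zigzags.Degree2 Γ x
allFacesI⇒¬degree2 Γ τ faces x p
  with y , y~x , _ , (z , _ , z∈τ , _ , _ , (z₁~r₁y , _) , _) , _ ← faces x =
  zigzag⇒¬degree2 (isZigzag-suc (ZOrientation.zigzags τ z∈τ))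
    (degree2-~ᵉ (~ᵉ-sym z₁~r₁y) (degree2-~ᶠ (~ᶠ-sym y~x ◅◅ r₁-~ᶠ) p))
  where
  open Triangulation Γ
  open MapProperties map
  open Zigzags Γ

module ToDigraph (Γ : Triangulation) (τ : ZOrientation Γ)
  (allFacesI : AllFacesI Γ τ) (allHomogeneous : AllHomogeneous Γ τ)
  (¬degree2 : ∀ x → ¬ Zigzags.Degree2 Γ x) {sign : Triangulation.Flag Γ → Bool}
  (encodes : ZOrientations.Encodes Γ ¬degree2 sign τ) where
  open Triangulation Γ
  open MapProperties map
  open TriangulationProperties Γ
  open Zigzags Γ
  open ZOrientations Γ ¬degree2

  private
    module I x = Equivalence (edgeI⇔ τ encodes x)
    module II x = Equivalence (edgeII⇔ τ encodes x)
    module Directed x = Equivalence (directedII⇔ τ encodes x)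

  open IsSign (encodes⇒isSign τ encodes)

  TypeI TypeII : Flag → Set
  TypeI x  = sign (r₂ x) ≡ not (sign x)
  TypeII x = sign (r₂ x) ≡ sign x

  typeI⇒¬typeII : ∀ {x} → TypeI x → ¬ TypeII x
  typeI⇒¬typeII p q = not-¬ q p

  side-typeI : ∀ {w} → TypeII w → TypeI (r₁ w)
  side-typeI {w} II with y , y~w , _ , I₁ , I₂ ← allFacesI w = go (~ᶠ⇒faceFlag y~w) II
    where
    go : ∀ {w} → FaceFlag y w → TypeII w → TypeI (r₁ w)
    go (same 0F)     _ = I.to _ I₁
    go (same 1F)     q = contradiction q (typeI⇒¬typeII (I.to _ I₁))
    go (same 2F)     q = contradiction q (typeI⇒¬typeII (typeI-~ᵉ r₀-~ᵉ (I.to _ I₁)))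
    go (opposite 0F) _ = I.to _ I₂
    go (opposite 1F) q = contradiction q (typeI⇒¬typeII (I.to _ I₂))
    go (opposite 2F) q = contradiction q (typeI⇒¬typeII (typeI-~ᵉ r₀-~ᵉ (I.to _ I₂)))

  -- This will be surjectivity of the isomorphism from `T` of the digraph: each face has an edge of
  -- type II, and `w` is a flag at one of its ends.
  corner-surjective : ∀ x → ∃₂ λ w i → TypeII w × corner (w , i) ≡ x
  corner-surjective x with y , y~x , II , _ ← allFacesI x = go (~ᶠ⇒faceFlag y~x)
    where
    go : ∀ {x} → FaceFlag y x → ∃₂ λ w i → TypeII w × corner (w , i) ≡ x
    go (same i)     = y , i , II.to _ II , refl
    go (opposite i) = r₀ y , i , typeII-~ᵉ r₀-~ᵉ (II.to _ II) , refl

  private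
    residue-mod-3 : ∀ {c m} → c ≤ m → ∃ λ k →
      m ≡ 3 * k + c ⊎ m ≡ 1 + (3 * k + c) ⊎ m ≡ 2 + (3 * k + c)
    residue-mod-3 {c} {m} c≤m with (m ∸ c) divMod 3 | ℕ.m∸n+n≡m c≤m
    ... | result k r d≡ | m≡ = k , split r d≡
      where
      recombine : ∀ n → m ∸ c ≡ n + k * 3 → m ≡ n + (3 * k + c)
      recombine n d≡ = begin
        m                 ≡⟨ m≡ ⟨
        (m ∸ c) + c       ≡⟨ cong (_+ c) d≡ ⟩
        n + k * 3 + c     ≡⟨ ℕ.+-assoc n (k * 3) c ⟩
        n + (k * 3 + c)   ≡⟨ cong (λ l → n + (l + c)) (ℕ.*-comm k 3) ⟩
        n + (3 * k + c)   ∎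
        where open ≡-Reasoning

      split : ∀ r → m ∸ c ≡ toℕ r + k * 3 →
              m ≡ 3 * k + c ⊎ m ≡ 1 + (3 * k + c) ⊎ m ≡ 2 + (3 * k + c)
      split 0F p = inj₁ (recombine 0 p)
      split 1F p = inj₂ (inj₁ (recombine 1 p))
      split 2F p = inj₂ (inj₂ (recombine 2 p))

  -- The offset of a homogeneous zigzag can be moved past any period.
  homogeneous-gap : ∀ {x} → sign x ≡ false → TypeII x → ¬ TypeII (next (next x))
  homogeneous-gap {x} p II₀ II₂
    with l , period ← Finite.finite-order (proj₂ finite) next-injective x
    with c , types ← allHomogeneous (zig x) (Equivalence.to (encodes x) p)
    with k , residue ← residue-mod-3 (ℕ.m≤m*n c (suc l))
    with _ , I₁ , I₂ ← types k
    = go (c * suc l) (iterate-* next x c (suc l) period) residue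
    where
    clash : ∀ {n y} → zig x n ≡ y → TypeII y → ¬ EdgeI Γ τ (zig x n)
    clash refl II e = typeI⇒¬typeII (I.to _ e) II

    j : ℕ
    j = 3 * k + c

    go : ∀ m → zig x m ≡ x → ¬ (m ≡ j ⊎ m ≡ 1 + j ⊎ m ≡ 2 + j)
    -- If `x` stands at the type II place of the pattern, the edge two steps later must be of type
    -- I. At the other two places `x` itself would be of type I.
    go m q (inj₁ refl)        = clash {2 + j}
      (trans (iterate-comm next (next x) j)
             (cong next (trans (iterate-comm next x j) (cong next q)))) II₂ I₂
    go m q (inj₂ (inj₁ refl)) = clash {1 + j} q II₀ I₁
    go m q (inj₂ (inj₂ refl)) = clash {2 + j} q II₀ I₂

  -- In the face across a side r₁ w of type I, the edge of type II must lie
  -- opposite the same hub, or else the zigzag through w and r₁ w, in one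
  -- direction or the other, has only one edge of type I between two of type II.
  rotate-typeII : ∀ {w} → TypeII w → TypeII (r₁ (r₂ (r₁ w)))
  rotate-typeII {w} II with corner-surjective (r₂ (r₁ w))
  ... | v , 0F , IIᵥ , refl =
    contradiction IIᵥ (typeI⇒¬typeII (typeI-~ᵉ r₂-~ᵉ (side-typeI II)))
  ... | v , 1F , IIᵥ , p = subst TypeII (trans (sym (r₁-invol v)) (cong r₁ p)) IIᵥ
  ... | v , 2F , IIᵥ , p = contradiction II-after (no-II-after (sign w) refl)
    where
    u : Flag
    u = r₂ (r₁ w)

    v≡ : v ≡ r₁ (r₀ u)
    v≡ = trans (sym (r₁-invol v)) (cong r₁ (trans (sym (r₀-invol _)) (cong r₀ p)))

    next-v : next v ≡ r₁ w
    next-v = begin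
      r₀ (r₂ (r₁ v))             ≡⟨ cong (r₀ ∘ r₂ ∘ r₁) v≡ ⟩
      r₀ (r₂ (r₁ (r₁ (r₀ u))))   ≡⟨ cong (r₀ ∘ r₂) (r₁-invol _) ⟩
      r₀ (r₂ (r₀ u))             ≡⟨ cong r₀ (r₀r₂-comm u) ⟨
      r₀ (r₀ (r₂ u))             ≡⟨ r₀-invol _ ⟩
      r₂ (r₂ (r₁ w))             ≡⟨ r₂-invol _ ⟩
      r₁ w                       ∎
      where open ≡-Reasoning

    II-after : TypeII (next (next w))
    II-after = typeII-~ᵉ (≡⇒~ᵉ v≡ ◅◅ r₁-~ᵉ-next) IIᵥ

    no-II-after : ∀ b → sign w ≡ b → ¬ TypeII (next (next w))
    no-II-after false s = homogeneous-gap s II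
    -- Now the reversal of `zig w` is in `τ`; it runs through the same three edges from `v` back to
    -- `w`.
    no-II-after true  s = contradiction
      (typeII-~ᵉ (≡⇒~ᵉ (sym (r₁-invol w)) ◅◅ r₁-~ᵉ-next ◅◅ ≡⇒~ᵉ (cong next (sym next-v))) II)
      (homogeneous-gap
        (trans (sym (sign-next v)) (trans (cong sign next-v) (trans (sign-r₁ w) (cong not s))))
        IIᵥ)

  DFlag : Set
  DFlag = Σ Flag TypeII

  DFlag-≡ : {x y : DFlag} → proj₁ x ≡ proj₁ y → x ≡ y
  DFlag-≡ refl = cong (_ ,_) (Decidable⇒UIP.≡-irrelevant Bool._≟_ _ _)

  private
    D-r₀ D-r₁ D-r₂ : DFlag → DFlag
    D-r₀ (x , p) = r₀ x , typeII-~ᵉ r₀-~ᵉ p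
    D-r₁ (x , p) = r₁ (r₂ (r₁ x)) , rotate-typeII p
    D-r₂ (x , p) = r₂ x , typeII-~ᵉ r₂-~ᵉ p

    toΓ : DFlag × Fin 3 → Flag
    toΓ ((x , _) , i) = corner (x , i)

    toΓ-r₁₂ : ∀ w → toΓ (D-r₁ w , 1F) ≡ r₂ (toΓ (w , 1F))
    toΓ-r₁₂ w = r₁-invol _

    toΓ-r₂₂ : ∀ w → toΓ (D-r₁ w , 2F) ≡ r₂ (toΓ (w , 2F))
    toΓ-r₂₂ w = trans (cong r₀ (r₁-invol _)) (r₀r₂-comm _)

    -- Equality would put `w` on the third side of the face of `v`, which is of type I.
    spokes-distinct : ∀ w v → toΓ (w , 1F) ≢ toΓ (v , 2F)
    spokes-distinct (w , p) (v , q) e = typeI⇒¬typeII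
      (typeI-~ᵉ r₀-~ᵉ (side-typeI (typeII-~ᵉ r₀-~ᵉ q)))
      (subst TypeII (trans (sym (r₁-invol w)) (trans (cong r₁ e) (r₁r₀r₁ v))) p)

    toΓ-injective : Injective _≡_ _≡_ toΓ
    toΓ-injective {w , 0F} {v , 0F} p = cong (_, 0F) (DFlag-≡ p)
    toΓ-injective {w , 1F} {v , 1F} p = cong (_, 1F) (DFlag-≡ (r₁-injective p))
    toΓ-injective {w , 2F} {v , 2F} p = cong (_, 2F) (DFlag-≡ (r₁-injective (r₀-injective p)))
    toΓ-injective {(w , p) , 0F} {(v , q) , 1F} refl =
      contradiction p (typeI⇒¬typeII (side-typeI q))
    toΓ-injective {(w , p) , 1F} {(v , q) , 0F} refl =
      contradiction q (typeI⇒¬typeII (side-typeI p))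
    toΓ-injective {(w , p) , 0F} {(v , q) , 2F} refl =
      contradiction p (typeI⇒¬typeII (typeI-~ᵉ r₀-~ᵉ (side-typeI q)))
    toΓ-injective {(w , p) , 2F} {(v , q) , 0F} refl =
      contradiction q (typeI⇒¬typeII (typeI-~ᵉ r₀-~ᵉ (side-typeI p)))
    toΓ-injective {w , 1F} {v , 2F} e = contradiction e (spokes-distinct w v)
    toΓ-injective {w , 2F} {v , 1F} e = contradiction (sym e) (spokes-distinct v w)

    -- The path in `Γ` is traced by the pairs `(w , i)`: each step changes only the index or applies
    -- one of the digraph involutions to `w`, and injectivity of `toΓ` identifies the end.
    D-connected : ∀ {x y} → Star (λ a b → r₀ a ≡ b ⊎ r₁ a ≡ b ⊎ r₂ a ≡ b) x y →
      ∀ w i v j → toΓ (w , i) ≡ x → toΓ (v , j) ≡ y →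
      Star (λ a b → D-r₀ a ≡ b ⊎ D-r₁ a ≡ b ⊎ D-r₂ a ≡ b) w v
    D-connected ε w i v j p q =
      subst (Star _ w) (cong proj₁ (toΓ-injective {w , i} {v , j} (trans p (sym q)))) ε
    D-connected (inj₁ refl ◅ s) w 0F v j refl q =
      inj₁ refl ◅ D-connected s (D-r₀ w) 0F v j refl q
    D-connected (inj₁ refl ◅ s) w 1F v j refl q = D-connected s w 2F v j refl q
    D-connected (inj₁ refl ◅ s) w 2F v j refl q = D-connected s w 1F v j (sym (r₀-invol _)) q
    D-connected (inj₂ (inj₁ refl) ◅ s) w 0F v j refl q = D-connected s w 1F v j refl q
    D-connected (inj₂ (inj₁ refl) ◅ s) w 1F v j refl q =
      D-connected s w 0F v j (sym (r₁-invol _)) q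
    D-connected (inj₂ (inj₁ refl) ◅ s) w 2F v j refl q =
      inj₁ refl ◅ D-connected s (D-r₀ w) 2F v j (sym (r₁r₀r₁ _)) q
    D-connected (inj₂ (inj₂ refl) ◅ s) w 0F v j refl q =
      inj₂ (inj₂ refl) ◅ D-connected s (D-r₂ w) 0F v j refl q
    D-connected (inj₂ (inj₂ refl) ◅ s) w 1F v j refl q =
      inj₂ (inj₁ refl) ◅ D-connected s (D-r₁ w) 1F v j (toΓ-r₁₂ w) q
    D-connected (inj₂ (inj₂ refl) ◅ s) w 2F v j refl q =
      inj₂ (inj₁ refl) ◅ D-connected s (D-r₁ w) 2F v j (toΓ-r₂₂ w) q

  digraphMap : Map
  digraphMap = record
    { Flag = DFlag
    ; finite = Finite.finite-subset (proj₂ finite)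
        (λ x → sign (r₂ x) Bool.≟ sign x) (Decidable⇒UIP.≡-irrelevant Bool._≟_)
    ; inhabited = let w , _ , II , _ = corner-surjective inhabited in w , II
    ; r₀ = D-r₀ ; r₁ = D-r₁ ; r₂ = D-r₂
    ; r₀-invol = λ _ → DFlag-≡ (r₀-invol _)
    ; r₁-invol = λ (x , _) → DFlag-≡ (begin
        r₁ (r₂ (r₁ (r₁ (r₂ (r₁ x)))))   ≡⟨ cong (r₁ ∘ r₂) (r₁-invol _) ⟩
        r₁ (r₂ (r₂ (r₁ x)))             ≡⟨ cong r₁ (r₂-invol _) ⟩
        r₁ (r₁ x)                       ≡⟨ r₁-invol x ⟩
        x                               ∎)
    ; r₂-invol = λ _ → DFlag-≡ (r₂-invol _)
    ; r₀-free = λ _ p → r₀-free _ (cong proj₁ p)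
    ; r₁-free = λ (x , _) p → r₂-free (r₁ x)
        (r₁-injective (trans (cong proj₁ p) (sym (r₁-invol x))))
    ; r₂-free = λ _ p → r₂-free _ (cong proj₁ p)
    ; r₀r₂-comm = λ _ → DFlag-≡ (r₀r₂-comm _)
    ; r₀r₂-free = λ _ p → r₀r₂-free _ (cong proj₁ p)
    ; connected = λ x y →
        D-connected (connected (proj₁ x) (proj₁ y)) x 0F y 0F refl refl }
    where open ≡-Reasoning

  private
    module D where
      open Map digraphMap public
      open MapProperties digraphMap public

    ~ᵛ⁻ : ∀ {x y} → x D.~ᵛ y → proj₁ x ~ᵛ proj₁ y
    ~ᵛ⁻ ε = ε
    ~ᵛ⁻ (inj₁ refl ◅ p) = r₁-~ᵛ ◅◅ r₂-~ᵛ ◅◅ r₁-~ᵛ ◅◅ ~ᵛ⁻ p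
    ~ᵛ⁻ (inj₂ refl ◅ p) = r₂-~ᵛ ◅◅ ~ᵛ⁻ p

    ~ᵉ⁺ : ∀ {x y} → proj₁ x ~ᵉ proj₁ y → x D.~ᵉ y
    ~ᵉ⁺ {x} {y} = go x y refl refl
      where
      go : ∀ {a b} x y → proj₁ x ≡ a → proj₁ y ≡ b → a ~ᵉ b → x D.~ᵉ y
      go x y p q ε = D.≡⇒~ᵉ (DFlag-≡ (trans p (sym q)))
      go x y p q (inj₁ refl ◅ s) = inj₁ refl ◅ go (D-r₀ x) y (cong r₀ p) q s
      go x y p q (inj₂ refl ◅ s) = inj₂ refl ◅ go (D-r₂ x) y (cong r₂ p) q s

    -- Both `D-r₀` and `D-r₁` move around the third corner of a triangle, which is thus the common
    -- centre of the whole digraph face.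
    same-hub : ∀ {x y} → x D.~ᶠ y → toΓ (x , 2F) ~ᵛ toΓ (y , 2F)
    same-hub ε = ε
    same-hub {x} (inj₁ refl ◅ p) = r₁-~ᵛ ◅◅ ≡⇒~ᵛ (r₁r₀r₁ _) ◅◅ same-hub p
    same-hub {x} (inj₂ refl ◅ p) = r₂-~ᵛ ◅◅ ≡⇒~ᵛ (sym (toΓ-r₂₂ x)) ◅◅ same-hub p

    sign-D-r₁ : ∀ x → sign (proj₁ (D-r₁ x)) ≡ not (sign (proj₁ x))
    sign-D-r₁ (x , II) = begin
      sign (r₁ (r₂ (r₁ x)))    ≡⟨ sign-r₁ _ ⟩
      not (sign (r₂ (r₁ x)))   ≡⟨ cong not (side-typeI II) ⟩
      not (not (sign (r₁ x)))  ≡⟨ not-involutive _ ⟩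
      sign (r₁ x)              ≡⟨ sign-r₁ x ⟩
      not (sign x)             ∎
      where open ≡-Reasoning

    D-simple : D.IsSimple
    D-simple = record
      { no-loops = λ x p → no-loops _ (~ᵛ⁻ p)
      ; no-multiedges = λ x y p q → ~ᵉ⁺ (no-multiedges _ _ (~ᵛ⁻ p) (~ᵛ⁻ q)) }

    -- Two corners of a face at one vertex give two spokes from this vertex to the same centre, and
    -- simplicity of `Γ` identifies them.
    vertex-once : ∀ x y → x D.~ᶠ y → x D.~ᵛ y → y ≡ x ⊎ y ≡ D-r₁ x
    vertex-once (x , _) (y , _) f v
      with sameVertex⇒sameDart simple tails (no-multiedges _ _ tails (same-hub f))
      where
      tails : r₁ x ~ᵛ r₁ y
      tails = ~ᵛ-sym r₁-~ᵛ ◅◅ ~ᵛ⁻ v ◅◅ r₁-~ᵛ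
    ... | inj₁ p = inj₁ (DFlag-≡ (r₁-injective (sym p)))
    ... | inj₂ p = inj₂ (DFlag-≡ (trans (sym (r₁-invol y)) (cong r₁ (sym p))))

    -- If the same face lay on both sides at this end, `vertex-once` would leave `D-r₂ x ≡ D-r₁ x`,
    -- but `D-r₂` keeps the sign and `D-r₁` changes it.
    dart-once : ∀ x y → x D.~ᶠ y → D.SameDart x y → y ≡ x
    dart-once x y f (inj₁ p) = sym p
    dart-once x y f (inj₂ refl) with vertex-once x y f D.r₂-~ᵛ
    ... | inj₁ p = p
    ... | inj₂ p = contradiction
      (trans (cong (sign ∘ proj₁) p) (sign-D-r₁ x)) (not-¬ (proj₂ x))

    edge-once : ∀ x y → x D.~ᶠ y → x D.~ᵉ y → y ≡ x ⊎ y ≡ D-r₀ x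
    edge-once x y f e with D.~ᵉ⇒sameDart e
    ... | inj₁ d = inj₁ (dart-once x y f d)
    ... | inj₂ d = inj₂ (dart-once (D-r₀ x) y (D.~ᶠ-sym D.r₀-~ᶠ ◅◅ f) d)

  digraph : EulerianEmbedding
  digraph = record
    { embedding = record
        { map = digraphMap ; simple = D-simple
        ; closed = record { vertex-once = vertex-once ; edge-once = edge-once } }
    ; orientation = orientation
    ; eulerian = OrientationProperties.directed⇒eulerian orientation directed
    ; directed-faces = directed }
    where
    orientation : Orientation digraphMap
    orientation = record
      { out = sign ∘ proj₁
      ; out-r₂ = proj₂
      ; out-r₀ = λ (x , p) → trans (sign-r₀ x) (cong not p) }

    directed : Orientation.HasDirectedFaces orientation
    directed x = begin
      sign (proj₁ (D-r₁ (D-r₀ x)))   ≡⟨ sign-D-r₁ (D-r₀ x) ⟩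
      not (sign (r₀ (proj₁ x)))      ≡⟨ cong not (Orientation.out-r₀ orientation x) ⟩
      not (not (sign (proj₁ x)))     ≡⟨ not-involutive _ ⟩
      sign (proj₁ x)                 ∎
      where open ≡-Reasoning

  T-digraph≅Γ : T-map (EulerianEmbedding.embedding digraph) ≅ map
  T-digraph≅Γ = record
    { bijection = mk↔ₛ′ toΓ from (proj₂ ∘ preimage)
        (λ p → toΓ-injective (proj₂ (preimage (toΓ p))))
    ; r₀-hom = λ where
        (w , 0F) → refl
        (w , 1F) → refl
        (w , 2F) → sym (r₀-invol _)
    ; r₁-hom = λ where
        (w , 0F) → refl
        (w , 1F) → sym (r₁-invol _)
        (w , 2F) → sym (r₁r₀r₁ _)
    ; r₂-hom = λ where
        (w , 0F) → refl
        (w , 1F) → toΓ-r₁₂ w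
        (w , 2F) → toΓ-r₂₂ w }
    where
    preimage : ∀ x → ∃ λ p → toΓ p ≡ x
    preimage x with w , i , II , p ← corner-surjective x = ((w , II) , i) , p
    from : Flag → DFlag × Fin 3
    from = proj₁ ∘ preimage

  isΓII : IsΓII digraph Γ τ T-digraph≅Γ
  isΓII = record
    { vertices = λ v → mk⇔ (rim-vertex v)
        λ { ((y , II) , y~v) all-I → typeI⇒¬typeII (I.to y (all-I y y~v)) II }
    ; edges = λ x → mk⇔
        (λ d → let p , q = Directed.to x d in (x , trans q (sym p)) , p , inj₁ refl)
        λ where
          ((y , II) , p , inj₁ refl) → Directed.from _ (p , trans II p)
          ((y , II) , p , inj₂ refl) → Directed.from _
            (trans II p , trans (cong sign (r₂-invol y)) p) }
    where
    hub-closed : ∀ w {a u} → toΓ (w , 2F) ≡ a → a ~ᵛ u → ∃ λ v → toΓ (v , 2F) ≡ u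
    hub-closed w p    ε = w , p
    hub-closed w refl (inj₁ refl ◅ s) = hub-closed (D-r₀ w) (sym (r₁r₀r₁ _)) s
    hub-closed w refl (inj₂ refl ◅ s) = hub-closed (D-r₁ w) (toΓ-r₂₂ w) s

    rim-vertex : ∀ v → VertexII Γ τ v → ∃ λ y → toΓ (y , 0F) ~ᵛ v
    rim-vertex v h with corner-surjective v
    ... | w , 0F , II , refl = (w , II) , ε
    ... | w , 1F , II , refl = (w , II) , r₁-~ᵛ
    ... | w , 2F , II , refl = contradiction
      (λ u u~v → let (y , p) , q = hub-closed (w , II) refl (~ᵛ-sym u~v) in
        I.from u (subst TypeI q (typeI-~ᵉ r₀-~ᵉ (side-typeI p)))) h

theorem1 : ((Γ : Triangulation) (τ : ZOrientation Γ) →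
    AllFacesI Γ τ → AllHomogeneous Γ τ →
    Σ[ D ∈ EulerianEmbedding ]
    Σ[ φ ∈ T-map (EulerianEmbedding.embedding D) ≅ Triangulation.map Γ ]
    IsΓII D Γ τ φ)
    ×
    ((D : EulerianEmbedding) →
    let Γ = T (EulerianEmbedding.embedding D)
        Good : ZOrientation Γ → Set
        Good τ = AllFacesI Γ τ × AllHomogeneous Γ τ × IsΓII D Γ τ ≅-refl
    in
    Σ[ τ ∈ ZOrientation Γ ]
    Good τ ×
    ((τ′ : ZOrientation Γ) → Good τ′ →
    ∀ z → ZOrientation._∈τ τ z ⇔ ZOrientation._∈τ τ′ z))
theorem1 =
  (λ Γ τ faces homogeneous →
    let ¬degree2 = allFacesI⇒¬degree2 Γ τ faces
        open ToDigraph Γ τ faces homogeneous ¬degree2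
               (ZOrientations.encodes-signOf Γ ¬degree2 τ)
    in digraph , T-digraph≅Γ , isΓII)
  , λ D → let open FromDigraph D in
    τ , (allFacesI , allHomogeneous , isΓII) , λ τ′ (_ , _ , Γ′-II) → unique τ′ Γ′-II
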